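{- Let $G$ be a connected graph with vertex set $X$ ($|X|\ge 2$). The following are equivalent: (i) $G$ is Ptolemaic; (ii) the underlying undirected graph of $H(K(G))$ is acyclic; (iii) $N(K(G))$ is arboreal; (iv) $G$ is arboreal representable; (v) $G$ is represented by some arboreal network on $X$ with $\mathrm{ecc}(G)=|K(G)|$ roots.
   Context: A graph is Ptolemaic if its shortest-path distance $d^*$ satisfies $d^*(x,y)d^*(z,u)+d^*(x,u)d^*(y,z)\ge d^*(x,z)d^*(y,u)$ for all vertices $x,y,z,u$. A clique is a set $Y$ of vertices with $|Y|\ge2$ that are pairwise adjacent; $K(G)$ is the set of maximal cliques of $G$. An edge clique cover of $G$ is a set $K$ of cliques of $G$ such that every edge of $G$ is contained in some member of $K$; $\mathrm{ecc}(G)$ is the minimum size of an edge clique cover. In a digraph, a leaf is a vertex of indegree 1 and outdegree 0, a root is a vertex of indegree 0. A network on $X$ is a simple acyclic digraph $N$ whose underlying undirected graph is connected, whose set of leaves is $X$, in which every vertex of indegree 0 has outdegree at least 2, every vertex of outdegree 0 has indegree 1, and no vertex has both indegree and outdegree equal to 1. $N$ is arboreal if its underlying undirected graph is a tree. Leaves $x\ne y$ share an ancestor if some vertex has directed paths (possibly of length 0) to both. The shared ancestry graph $\mathcal A(N)$ has vertex set $X$, distinct $x,y$ adjacent iff they share an ancestor in $N$. $N$ represents $G$ if $\mathcal A(N)=G$ (same edge set on $X$); $G$ is arboreal representable if some arboreal network on $X$ represents it. For a set $\mathcal C$ of non-empty subsets of $X$, the cover digraph $H(\mathcal C)$ has vertex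 set $\mathcal C$ and an arc $(A,B)$ iff $B\subsetneq A$ and no $C\in\mathcal C$ satisfies $B\subsetneq C\subsetneq A$. The digraph $N(\mathcal C)$ is obtained from $H(\mathcal C)$ by: adding, for each $x\in X$ with $\{x\}\notin\mathcal C$, a new vertex $\{x\}$ of outdegree 0, and an arc from each vertex $A$ of $H(\mathcal C)$ to $\{x\}$ whenever $x\in A$ and no child of $A$ in $H(\mathcal C)$ contains $x$; then adding a new child to every vertex of outdegree 0 and indegree at least 2; then identifying each leaf $l$ with the unique $x\in X$ such that $l=\{x\}$ or $l$ is the child of $\{x\}$. For a set $K$ of cliques, $\mathcal C(K)=\{\bigcap_{Y\in S}Y : \emptyset\ne S\subseteq K,\ \bigcap_{Y\in S}Y\ne\emptyset\}$ and $N(K)=N(\mathcal C(K))$.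
   Formalization: In (ii), H(K(G)) is read as H(C(K(G))), the cover digraph of all non-empty intersections of maximal cliques; taken literally H(K(G)) has no arcs, so (ii) would always hold and the equivalence would fail, e.g. for the 4-cycle. -}

module Defs where

open import Data.Nat using (ℕ; zero; suc; _+_; _*_; _≤_; _≡ᵇ_)
open import Data.Bool using (Bool; true; false; if_then_else_)
open import Data.Fin using (Fin)
open import Data.Fin.Subset using (Subset; _∈_; _∉_; _⊆_; _⊂_; _∩_; ∣_∣; Nonempty; ⁅_⁆)
open import Data.List using (List; []; _∷_; length; foldr)
open import Data.List.Relation.Unary.All using (All)
open import Data.List.Relation.Unary.Any using (Any)
open import Data.List.Relation.Unary.Unique.Propositional using (Unique)
open import Data.List.Membership.Propositional renaming (_∈_ to _∈ₗ_)
open import Data.Product using (Σ; ∃; ∃-syntax; _×_; _,_)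
open import Data.Sum using (_⊎_)
open import Data.Unit using (⊤)
open import Data.Empty using (⊥)
open import Relation.Nullary using (¬_)
open import Relation.Binary.PropositionalEquality using (_≡_; _≢_)
open import Function.Bundles using (_⇔_)

record Graph (n : ℕ) : Set where
  field
    adj    : Fin n → Fin n → Bool
    sym    : ∀ x y → adj x y ≡ adj y x
    irrefl : ∀ x → adj x x ≡ false
open Graph public

data Walk {n} (G : Graph n) : Fin n → Fin n → ℕ → Set where
  wnil  : ∀ {x} → Walk G x x 0
  wcons : ∀ {x z y k} → adj G x z ≡ true → Walk G z y k → Walk G x y (suc k)

Connected : ∀ {n} → Graph n → Set
Connected G = ∀ x y → ∃[ k ] Walk G x y k

IsDist : ∀ {n} → Graph n → Fin n → Fin n → ℕ → Set
IsDist G x y d = Walk G x y d × (∀ k → Walk G x y k → d ≤ k)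

Ptolemaic : ∀ {n} → Graph n → Set
Ptolemaic G = ∀ x y z u (dxy dzu dxu dyz dxz dyu : ℕ) →
  IsDist G x y dxy → IsDist G z u dzu → IsDist G x u dxu →
  IsDist G y z dyz → IsDist G x z dxz → IsDist G y u dyu →
  dxz * dyu ≤ dxy * dzu + dxu * dyz

Clique : ∀ {n} → Graph n → Subset n → Set
Clique G Y = 2 ≤ ∣ Y ∣ × (∀ x y → x ∈ Y → y ∈ Y → x ≢ y → adj G x y ≡ true)

MaxClique : ∀ {n} → Graph n → Subset n → Set
MaxClique G Y = Clique G Y × (∀ Z → Clique G Z → Y ⊆ Z → Z ≡ Y)

NumMaxCliques : ∀ {n} → Graph n → ℕ → Set
NumMaxCliques G k =
  ∃[ L ] (Unique L × (∀ Y → (Y ∈ₗ L) ⇔ MaxClique G Y) × length L ≡ k)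

EdgeCliqueCover : ∀ {n} → Graph n → List (Subset n) → Set
EdgeCliqueCover G L =
  Unique L × All (Clique G) L ×
  (∀ x y → adj G x y ≡ true → Any (λ Y → x ∈ Y × y ∈ Y) L)

IsEcc : ∀ {n} → Graph n → ℕ → Set
IsEcc G k = (∃[ L ] (EdgeCliqueCover G L × length L ≡ k)) ×
            (∀ L → EdgeCliqueCover G L → k ≤ length L)

-- Undirected graphs on a type V with vertex predicate Vt and edge relation E
-- (the edge relation used below is always symmetric)

data UWalk {V : Set} (E : V → V → Set) : V → V → Set where
  unil  : ∀ {u} → UWalk E u u
  ucons : ∀ {u w v} → E u w → UWalk E w v → UWalk E u v

UConnected : {V : Set} → (V → Set) → (V → V → Set) → Set
UConnected Vt E = ∀ u v → Vt u → Vt v → UWalk E u v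

ClosedChain : {V : Set} → (V → V → Set) → V → List V → Set
ClosedChain E v₀ [] = ⊥
ClosedChain E v₀ (v ∷ []) = E v v₀
ClosedChain E v₀ (v ∷ w ∷ vs) = E v w × ClosedChain E v₀ (w ∷ vs)

IsCycle : {V : Set} → (V → Set) → (V → V → Set) → List V → Set
IsCycle Vt E [] = ⊥
IsCycle Vt E (v₀ ∷ vs) =
  3 ≤ length (v₀ ∷ vs) × Unique (v₀ ∷ vs) × All Vt (v₀ ∷ vs) × ClosedChain E v₀ (v₀ ∷ vs)

UAcyclic : {V : Set} → (V → Set) → (V → V → Set) → Set
UAcyclic Vt E = ∀ cs → ¬ IsCycle Vt E cs

UTree : {V : Set} → (V → Set) → (V → V → Set) → Set
UTree Vt E = UConnected Vt E × UAcyclic Vt E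

Und : {V : Set} → (V → V → Set) → V → V → Set
Und A u v = A u v ⊎ A v u

HArc : ∀ {n} → (Subset n → Set) → Subset n → Subset n → Set
HArc 𝒞 A B = 𝒞 A × 𝒞 B × B ⊂ A × ¬ (∃[ C ] (𝒞 C × B ⊂ C × C ⊂ A))

IntersectionClosure : ∀ {n} → (Subset n → Set) → Subset n → Set
IntersectionClosure K A =
  ∃[ Y ] ∃[ Ys ] (All K (Y ∷ Ys) × A ≡ foldr _∩_ Y Ys × Nonempty A)

V₁ : ∀ {n} → (Subset n → Set) → Subset n → Set
V₁ 𝒞 A = 𝒞 A ⊎ (∃[ x ] (A ≡ ⁅ x ⁆ × ¬ 𝒞 ⁅ x ⁆))

Arc₁ : ∀ {n} → (Subset n → Set) → Subset n → Subset n → Set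
Arc₁ 𝒞 A B = HArc 𝒞 A B ⊎
  (𝒞 A × ∃[ x ] (B ≡ ⁅ x ⁆ × ¬ 𝒞 ⁅ x ⁆ × x ∈ A ×
                 ¬ (∃[ C ] (HArc 𝒞 A C × x ∈ C))))

-- stage 2: add a new child (pd A) to each vertex A of outdegree 0, indegree ≥ 2
data NVert (n : ℕ) : Set where
  nd : Subset n → NVert n
  pd : Subset n → NVert n

V₂ : ∀ {n} → (Subset n → Set) → NVert n → Set
V₂ 𝒞 (nd A) = V₁ 𝒞 A
V₂ 𝒞 (pd A) = V₁ 𝒞 A × (∀ B → ¬ Arc₁ 𝒞 A B) ×
              (∃[ B ] ∃[ C ] (B ≢ C × Arc₁ 𝒞 B A × Arc₁ 𝒞 C A))

Arc₂ : ∀ {n} → (Subset n → Set) → NVert n → NVert n → Set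
Arc₂ 𝒞 (nd A) (nd B) = Arc₁ 𝒞 A B
Arc₂ 𝒞 (nd A) (pd B) = A ≡ B × V₂ 𝒞 (pd B)
Arc₂ 𝒞 (pd A) _      = ⊥

-- (the final identification of leaves with X is a relabelling and does not
--  affect the underlying undirected graph)
-- N(K) := N(𝒞(K)) is arboreal: its underlying undirected graph is a tree
NArboreal : ∀ {n} → (Subset n → Set) → Set
NArboreal K = UTree (V₂ (IntersectionClosure K)) (Und (Arc₂ (IntersectionClosure K)))

countF : ∀ {m} → (Fin m → Bool) → ℕ
countF {zero}  f = 0
countF {suc m} f = (if f Fin.zero then 1 else 0) + countF (λ i → f (Fin.suc i))

data Reach {m} (arc : Fin m → Fin m → Bool) : Fin m → Fin m → Set where
  rnil  : ∀ {v} → Reach arc v v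
  rcons : ∀ {u w v} → arc u w ≡ true → Reach arc w v → Reach arc u v

record Network (n : ℕ) : Set where
  field
    m    : ℕ
    arc  : Fin m → Fin m → Bool
    leaf : Fin n → Fin m
  indeg : Fin m → ℕ
  indeg v = countF (λ u → arc u v)
  outdeg : Fin m → ℕ
  outdeg v = countF (λ w → arc v w)
  field
    loopless      : ∀ v → arc v v ≡ false
    acyclic       : ∀ u v → arc u v ≡ true → ¬ Reach arc v u
    connected     : UConnected (λ _ → ⊤) (Und (λ u v → arc u v ≡ true))
    leaf-inj      : ∀ x y → leaf x ≡ leaf y → x ≡ y
    leaves        : ∀ v → (indeg v ≡ 1 × outdeg v ≡ 0) ⇔ (∃[ x ] leaf x ≡ v)
    root-outdeg   : ∀ v → indeg v ≡ 0 → 2 ≤ outdeg v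
    sink-indeg    : ∀ v → outdeg v ≡ 0 → indeg v ≡ 1
    no-subdivided : ∀ v → ¬ (indeg v ≡ 1 × outdeg v ≡ 1)
open Network public

Arboreal : ∀ {n} → Network n → Set
Arboreal N = UTree (λ _ → ⊤) (Und (λ u v → arc N u v ≡ true))

ShareAncestor : ∀ {n} → Network n → Fin n → Fin n → Set
ShareAncestor N x y = ∃[ v ] (Reach (arc N) v (leaf N x) × Reach (arc N) v (leaf N y))

Represents : ∀ {n} → Network n → Graph n → Set
Represents N G = ∀ x y → x ≢ y → (adj G x y ≡ true) ⇔ ShareAncestor N x y

ArborealRepresentable : ∀ {n} → Graph n → Set
ArborealRepresentable G = ∃[ N ] (Arboreal N × Represents N G)

numRoots : ∀ {n} → Network n → ℕ
numRoots N = countF (λ v → indeg N v ≡ᵇ 0)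

{-# OPTIONS --safe #-}

-- (i) ⇒ (ii).  In a Ptolemaic graph induced paths are geodesic, and there is neither an induced
-- 4-cycle nor a gem.  Let A cover B in the cover digraph and let a ∈ A ∖ B.  Some maximal clique
-- Q ⊇ B has a vertex q not adjacent to a; the common neighbours of a and q are exactly B, so B
-- separates a from q.  "Meeting the component of a in G − B" is then an invariant of every edge
-- of the cover digraph except (A , B), which makes that edge a bridge.
--
-- (ii) ⇒ (iii) ⇒ (iv), (v).  N(K(G)) arises from the cover digraph by attaching pendant vertices
-- only, because the least closed set containing a given vertex of G is unique.  Its roots are the
-- maximal cliques, and each of these owns an edge lying in no other maximal clique, so that no
-- edge clique cover is smaller.
--
-- (iv) ⇒ (i).  Join two vertices of an arboreal network when they share an ancestor.  Since every
-- vertex has a leaf below it, this graph retracts onto G, so distances in G can be computed in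
-- it, where they count the peaks of tree paths.  Ptolemy's inequality for the peak count is proved
-- by adding the vertices of the tree one at a time.

module Submission where

open import Defs
open import Data.Bool using (Bool; true; false; if_then_else_; _∨_; T)
import Data.Bool.Properties as Bool
open import Data.Empty using (⊥; ⊥-elim)
open import Data.Fin using (Fin; zero; suc)
open import Data.Fin.Induction using (spo-noetherian)
import Data.Fin.Properties as Fin
open import Data.Fin.Properties using (any?; all?; ¬∀⟶∃¬; injective⇒≤) renaming (_≟_ to _≟F_)
open import Data.Fin.Subset using (Subset; _∈_; _∉_; _⊆_; _⊂_; _∩_; _∪_; ∣_∣; Nonempty; ⁅_⁆; inside; outside) renaming (⊥ to ∅)
open import Data.Fin.Subset.Properties using (Empty-unique; _∈?_; _⊂?_; _⊆?_; anySubset?; nonempty?; p∩q⊆p; p∩q⊆q; p⊂q⇒∣p∣<∣q∣; p⊆p∪q; p⊆q⇒∣p∣≤∣q∣; x∈p∩q⁺; x∈p∩q⁻; x∈p∪q⁺; x∈p∪q⁻; x∈⁅x⁆; x∈⁅y⁆⇒x≡y; ∣p∣≤n; ∣p∣≤∣p∪q∣; ∣⁅x⁆∣≡1; ∣⊥∣≡0; ⊆-antisym)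
open import Data.List using (List; []; _∷_; length; foldr; map; filter; _++_; deduplicate; lookup; allFin)
open import Data.List.Membership.Propositional using (find; lose) renaming (_∈_ to _∈ₗ_)
open import Data.List.Membership.Propositional.Properties using (∈-map⁺; ∈-map⁻; ∈-filter⁺; ∈-filter⁻; ∈-++⁺ˡ; ∈-++⁺ʳ; ∈-++⁻; ∈-∃++; ∈-deduplicate⁺; ∈-lookup; ∈-allFin)
open import Data.List.Properties using (length-map; length-++)
open import Data.List.Relation.Unary.All using (All; []; _∷_)
import Data.List.Relation.Unary.All as All
import Data.List.Relation.Unary.All.Properties as All
open import Data.List.Relation.Unary.AllPairs using ([]; _∷_)
open import Data.List.Relation.Unary.Any using (Any; here; there; index)
import Data.List.Relation.Unary.Any as Any
import Data.List.Relation.Unary.Any.Properties as Any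
open import Data.List.Relation.Unary.Unique.Propositional using (Unique)
import Data.List.Relation.Unary.Unique.Propositional.Properties as Unique
import Data.List.Relation.Unary.Unique.DecPropositional.Properties as UniqueDec
open import Data.Nat using (ℕ; zero; suc; _+_; _*_; _≤_; _<_; z≤n; s≤s; _⊔_; _≤?_; _≡ᵇ_)
open import Data.Nat.Properties using (*-comm; *-identityʳ; *-identityˡ; *-monoʳ-≤; *-monoˡ-≤; *-suc; *-zeroʳ; +-assoc; +-cancelʳ-≤; +-comm; +-identityʳ; +-mono-≤; +-monoʳ-≤; +-monoˡ-≤; +-suc; 1+n≰n; <⇒≢; <⇒≱; m≤m+n; m≤m⊔n; m≤n+m; m≤n⇒m≤1+n; m≤n⇒m⊔n≡n; m≤n⊔m; n≤1+n; suc-injective; ≡ᵇ⇒≡; ≡⇒≡ᵇ; ≤-antisym; ≤-pred; ≤-refl; ≤-reflexive; ≤-trans; ≰⇒>; ⊔-lub)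
open import Data.Nat.Tactic.RingSolver using (solve-∀)
open import Data.Product using (Σ; ∃-syntax; _×_; _,_; proj₁; proj₂)
open import Data.Sum using (_⊎_; inj₁; inj₂)
open import Data.Unit using (⊤; tt)
open import Data.Vec using () renaming ([] to []ᵥ; _∷_ to _∷ᵥ_)
import Data.Vec.Properties as Vec
open import Function.Base using (flip)
open import Function.Bundles using (_⇔_; mk⇔; Equivalence)
open import Induction.WellFounded using (Acc; acc)
open import Relation.Binary.Definitions using (DecidableEquality)
open import Relation.Binary.PropositionalEquality using (_≡_; _≢_; refl; cong; cong₂; subst; subst₂; isEquivalence) renaming (sym to ≡-sym; trans to ≡-trans)
open import Relation.Binary.Structures using (IsStrictPartialOrder)
open import Relation.Nullary using (¬_; Dec; yes; no; does)
open import Relation.Nullary.Decidable using (_×-dec_; _⊎-dec_; _→-dec_; ¬?; map′; dec-true)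
open import Relation.Unary using (Decidable)

true≢false : ∀ {b} → b ≡ true → b ≡ false → ⊥
true≢false refl ()

-- Walks, cycles and bridges

Cut : {V : Set} → (V → V → Set) → V → V → V → V → Set
Cut E a b u v = E u v × ¬ (u ≡ a × v ≡ b) × ¬ (u ≡ b × v ≡ a)

module _ {V : Set} where

  UWalk-map : {E F : V → V → Set} → (∀ {u v} → E u v → F u v) → ∀ {u v} → UWalk E u v → UWalk F u v
  UWalk-map f unil        = unil
  UWalk-map f (ucons e p) = ucons (f e) (UWalk-map f p)

  _++ᵤ_ : {E : V → V → Set} → ∀ {u v w} → UWalk E u v → UWalk E v w → UWalk E u w
  unil      ++ᵤ q = q
  ucons e p ++ᵤ q = ucons e (p ++ᵤ q)

  UWalk-sym : {E : V → V → Set} → (∀ {u v} → E u v → E v u) → ∀ {u v} → UWalk E u v → UWalk E v u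
  UWalk-sym s unil        = unil
  UWalk-sym s (ucons e p) = UWalk-sym s p ++ᵤ ucons (s e) unil

  Und-sym : {A : V → V → Set} → ∀ {u v} → Und A u v → Und A v u
  Und-sym (inj₁ a) = inj₂ a
  Und-sym (inj₂ a) = inj₁ a

  Cut-sym : {E : V → V → Set} → (∀ {u v} → E u v → E v u) → ∀ {a b u v} → Cut E a b u v → Cut E a b v u
  Cut-sym s (e , p , q) = s e , (λ (x , y) → q (y , x)) , (λ (x , y) → p (y , x))

  crossing : {E : V → V → Set} {P : V → Set} → Decidable P → ∀ {u v} → UWalk E u v → P u → ¬ P v →
    ∃[ x ] ∃[ y ] (E x y × P x × ¬ P y)
  crossing P? unil pu ¬pv = ⊥-elim (¬pv pu)
  crossing P? (ucons {u} {w} e p) pu ¬pv with P? w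
  ... | yes pw = crossing P? p pw ¬pv
  ... | no ¬pw = u , w , e , pu , ¬pw

  module _ {E : V → V → Set} where

    private
      detour-tail : ∀ {a b} w ws → ClosedChain E a (w ∷ ws) → All (a ≢_) (w ∷ ws) → All (b ≢_) (w ∷ ws) →
        UWalk (Cut E a b) w a
      detour-tail w []       e       (a≢ ∷ _) (b≢ ∷ _) =
        ucons (e , (λ (x , _) → a≢ (≡-sym x)) , (λ (x , _) → b≢ (≡-sym x))) unil
      detour-tail w (v ∷ ws) (e , c) (a≢ ∷ as) (b≢ ∷ bs) =
        ucons (e , (λ (x , _) → a≢ (≡-sym x)) , (λ (x , _) → b≢ (≡-sym x))) (detour-tail v ws c as bs)

    cycle⇒detour : ∀ {Vt : V → Set} cs → IsCycle Vt E cs → ∃[ a ] ∃[ b ] (E a b × UWalk (Cut E a b) b a)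
    cycle⇒detour (a ∷ []) (s≤s () , _)
    cycle⇒detour (a ∷ b ∷ []) (s≤s (s≤s ()) , _)
    cycle⇒detour (a ∷ b ∷ c ∷ ws) (_ , (a≢b ∷ a≢c ∷ as) ∷ bs ∷ _ , _ , ab , bc , ch) =
      a , b , ab , ucons (bc , (λ (x , _) → a≢b (≡-sym x)) , (λ (_ , x) → a≢c (≡-sym x)))
                         (detour-tail c ws ch (a≢c ∷ as) bs)

  Trail : (V → V → Set) → V → List V → V → Set
  Trail F u []       v = u ≡ v
  Trail F u (w ∷ ws) v = F u w × Trail F w ws v

  module _ {F : V → V → Set} (_≟_ : DecidableEquality V) where

    private
      cut-back : ∀ {u v} w ws → u ∈ₗ (w ∷ ws) → Unique (w ∷ ws) → Trail F w ws v →
        ∃[ ws′ ] (Unique (u ∷ ws′) × Trail F u ws′ v)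
      cut-back w ws (here refl) un t = ws , un , t
      cut-back w (x ∷ ws) (there i) (_ ∷ un) (_ , t) = cut-back x ws i un t

    loop-erase : ∀ {u v} → UWalk F u v → ∃[ ws ] (Unique (u ∷ ws) × Trail F u ws v)
    loop-erase unil = [] , [] ∷ [] , refl
    loop-erase {u} (ucons {w = w} e p) with loop-erase p
    ... | ws , un , t with Any.any? (u ≟_) (w ∷ ws)
    ...   | yes i = cut-back w ws i un t
    ...   | no ¬i = w ∷ ws , All.¬Any⇒All¬ _ ¬i ∷ un , e , t

  module _ {E : V → V → Set} {Vt : V → Set} (vt : ∀ {u v} → E u v → Vt u × Vt v) (_≟_ : DecidableEquality V) where

    private
      close : ∀ {a b c} x ws → E a c → Trail (Cut E a b) x ws a → ClosedChain E c (x ∷ ws)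
      close x []       e refl          = e
      close x (w ∷ ws) e ((f , _) , t) = f , close w ws e t

      all-vt : ∀ {a b} x ws → Vt x → Trail (Cut E a b) x ws a → All Vt (x ∷ ws)
      all-vt x []       v t             = v ∷ []
      all-vt x (w ∷ ws) v ((f , _) , t) = v ∷ all-vt w ws (proj₂ (vt f)) t

    detour⇒cycle : ∀ {a b} → E a b → a ≢ b → UWalk (Cut E a b) b a → ∃[ cs ] IsCycle Vt E cs
    detour⇒cycle {a} {b} e a≢b p with loop-erase _≟_ p
    ... | [] , _ , b≡a = ⊥-elim (a≢b (≡-sym b≡a))
    ... | x ∷ [] , _ , (_ , _ , ¬c) , refl = ⊥-elim (¬c (refl , refl))
    ... | ws@(x ∷ y ∷ _) , un , t =
      b ∷ ws , s≤s (s≤s (s≤s z≤n)) , un , all-vt b ws (proj₂ (vt e)) t , close b ws e t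

    acyclic⇒bridge : UAcyclic Vt E → ∀ {a b} → E a b → a ≢ b → ¬ UWalk (Cut E a b) b a
    acyclic⇒bridge ac e a≢b p with detour⇒cycle e a≢b p
    ... | cs , c = ac cs c

-- Peak distances in oriented trees

-- Oriented trees built by attaching one vertex at a time; index zero is the newest vertex.
data OTree (V : Set) : ℕ → Set where
  single    : V → OTree V 1
  addChild  : ∀ {k} → OTree V k → Fin k → V → OTree V (suc k)
  addParent : ∀ {k} → OTree V k → Fin k → V → OTree V (suc k)

extendδ : ∀ {k} → (Fin k → Fin k → ℕ) → (Fin k → ℕ) → Fin (suc k) → Fin (suc k) → ℕ
extendδ d t zero    zero    = 0
extendδ d t zero    (suc j) = t j
extendδ d t (suc i) zero    = t i
extendδ d t (suc i) (suc j) = d i j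

extendDown : ∀ {k} → (Fin k → Fin k → Bool) → Bool → (Fin k → Bool) → Fin (suc k) → Fin (suc k) → Bool
extendDown dn out inn zero    zero    = false
extendDown dn out inn zero    (suc j) = out
extendDown dn out inn (suc i) zero    = inn i
extendDown dn out inn (suc i) (suc j) = dn i j

childIn : ∀ {k} → (Fin k → Fin k → Bool) → Fin k → Fin k → Bool
childIn dn s i = does (i ≟F s) ∨ dn i s

childδ : ∀ {k} → (Fin k → Fin k → ℕ) → Fin k → Fin k → ℕ
childδ d s x = 1 ⊔ d s x

parentδ : ∀ {k} → (Fin k → Fin k → ℕ) → (Fin k → Fin k → Bool) → Fin k → Fin k → ℕ
parentδ d dn s x = if dn s x then d s x else suc (d s x)

module _ {V : Set} where

  label : ∀ {k} → OTree V k → Fin k → V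
  label (single v)        _       = v
  label (addChild T s v)  zero    = v
  label (addChild T s v)  (suc i) = label T i
  label (addParent T s v) zero    = v
  label (addParent T s v) (suc i) = label T i

  TArc : ∀ {k} → OTree V k → Fin k → Fin k → Set
  TArc (single v)        _       _       = ⊥
  TArc (addChild T s v)  zero    _       = ⊥
  TArc (addChild T s v)  (suc i) zero    = i ≡ s
  TArc (addChild T s v)  (suc i) (suc j) = TArc T i j
  TArc (addParent T s v) zero    zero    = ⊥
  TArc (addParent T s v) zero    (suc j) = j ≡ s
  TArc (addParent T s v) (suc i) zero    = ⊥
  TArc (addParent T s v) (suc i) (suc j) = TArc T i j

  -- down T x y : the tree path from x to y leaves x along an arc pointing away from x.
  down : ∀ {k} → OTree V k → Fin k → Fin k → Bool
  down (single v)        = λ _ _ → false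
  down (addChild T s v)  = extendDown (down T) false (childIn (down T) s)
  down (addParent T s v) = extendDown (down T) true (λ i → down T i s)

  -- δ T x y is the number of peaks of the tree path from x to y, where an end of the path that is
  -- left downwards counts as a peak.
  δ : ∀ {k} → OTree V k → Fin k → Fin k → ℕ
  δ (single v)        = λ _ _ → 0
  δ (addChild T s v)  = extendδ (δ T) (childδ (δ T) s)
  δ (addParent T s v) = extendδ (δ T) (parentδ (δ T) (down T) s)

Tri : ℕ → ℕ → ℕ → Set
Tri a b c = a ≤ b + c × b ≤ a + c × c ≤ a + b

Tri-swap₁₂ : ∀ {a b c} → Tri a b c → Tri b a c
Tri-swap₁₂ {a} {b} {c} (p , q , r) = q , p , subst (c ≤_) (+-comm a b) r

Tri-swap₂₃ : ∀ {a b c} → Tri a b c → Tri a c b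
Tri-swap₂₃ {a} {b} {c} (p , q , r) = subst (a ≤_) (+-comm b c) p , r , q

Tri-degenerate : ∀ {a b c} → a ≡ b → c ≡ 0 → Tri a b c
Tri-degenerate {a} refl refl = m≤m+n a 0 , m≤m+n a 0 , z≤n

record TreeMetric {k : ℕ} (δ : Fin k → Fin k → ℕ) (down : Fin k → Fin k → Bool) : Set where
  field
    δ-diag   : ∀ x → δ x x ≡ 0
    δ-sym    : ∀ x y → δ x y ≡ δ y x
    δ-pos    : ∀ {x y} → x ≢ y → 1 ≤ δ x y
    δ-tri    : ∀ x y z → δ x z ≤ δ x y + δ y z
    down-diag : ∀ x → down x x ≡ false
    down-up  : ∀ {s x y} → down s x ≡ true → down s y ≡ false → y ≢ s → suc (δ x y) ≡ δ s x + δ s y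
    down-down : ∀ {s x y} → down s x ≡ true → down s y ≡ true → suc (δ x y) ≤ δ s x + δ s y
    down-sep : ∀ {s x y} → down s x ≡ true → down s y ≡ false → y ≢ s →
               down x y ≡ down x s × down y x ≡ down y s
    down-both : ∀ {x y} → down x y ≡ true → down y x ≡ true → 2 ≤ δ x y
    ptolemy  : ∀ w x y z → Tri (δ w x * δ y z) (δ w y * δ x z) (δ w z * δ x y)

Tri-resp : ∀ {a a′ b b′ c c′} → a ≡ a′ → b ≡ b′ → c ≡ c′ → Tri a b c → Tri a′ b′ c′
Tri-resp refl refl refl t = t

Tri-+ : ∀ {a b c a′ b′ c′} → Tri a b c → Tri a′ b′ c′ → Tri (a + a′) (b + b′) (c + c′)
Tri-+ {a} {b} {c} {a′} {b′} {c′} (p , q , r) (p′ , q′ , r′) =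
  subst (a + a′ ≤_) (exch b c b′ c′) (+-mono-≤ p p′) ,
  subst (b + b′ ≤_) (exch a c a′ c′) (+-mono-≤ q q′) ,
  subst (c + c′ ≤_) (exch a b a′ b′) (+-mono-≤ r r′)
  where
  exch : ∀ x y x′ y′ → (x + y) + (x′ + y′) ≡ (x + x′) + (y + y′)
  exch = solve-∀

private
  slack : ∀ {a b} c → a + c ≡ b → a ≤ b
  slack {a} c refl = m≤m+n a c

  e≤2pq : ∀ {e} p q → e ≤ suc p + suc q → e ≤ suc p * suc q + suc q * suc p
  e≤2pq p q h = ≤-trans h (slack (p + q + 2 * (p * q)) (eq p q))
    where
    eq : ∀ p q → suc p + suc q + (p + q + 2 * (p * q)) ≡ suc p * suc q + suc q * suc p
    eq = solve-∀

  Tri-twin : ∀ {e} p q → 1 ≤ p → 1 ≤ q → e ≤ p + q → Tri (1 * e) (p * q) (q * p)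
  Tri-twin {e} (suc p) (suc q) _ _ h =
    subst (_≤ suc p * suc q + suc q * suc p) (≡-sym (*-identityˡ e)) (e≤2pq p q h) ,
    ≤-trans (≤-reflexive (*-comm (suc p) (suc q))) (m≤n+m _ (1 * e)) ,
    ≤-trans (≤-reflexive (*-comm (suc q) (suc p))) (m≤n+m _ (1 * e))

  DUU-step : ∀ {q r e} p → q ≤ e + r → r ≤ e + q → suc q * (p + r) ≤ suc p * e + suc r * (p + q)
  DUU-step {q} {r} {e} p h h′ = subst₂ _≤_ (l p q r) (rr p q r e) (+-monoʳ-≤ (p + q * r) (+-mono-≤ h′ (*-monoˡ-≤ p h)))
    where
    l : ∀ p q r → (p + q * r) + (r + q * p) ≡ suc q * (p + r)
    l = solve-∀
    rr : ∀ p q r e → (p + q * r) + ((e + q) + (e + r) * p) ≡ suc p * e + suc r * (p + q)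
    rr = solve-∀

  Tri-DUU : ∀ {p q r e a b} → 1 ≤ p → suc a ≡ p + q → suc b ≡ p + r → Tri e q r →
    Tri (p * e) (suc q * b) (suc r * a)
  Tri-DUU {suc p} {q} {r} {e} _ refl refl (h₁ , h₂ , h₃) =
    ≤-trans (*-monoʳ-≤ (suc p) h₁) (slack (2 * p + 2 * (q * r)) (eq p q r)) ,
    DUU-step p h₂ h₃ , DUU-step p h₃ h₂
    where
    eq : ∀ p q r → suc p * (q + r) + (2 * p + 2 * (q * r)) ≡ suc q * (p + r) + suc r * (p + q)
    eq = solve-∀

  DDU-step : ∀ {p q e} r → p ≤ q + e → q ≤ p + e → suc p * (q + r) ≤ suc q * (p + r) + suc r * e
  DDU-step {p} {q} {e} r h h′ = subst₂ _≤_ (l p q r) (rr p q r e) (+-monoʳ-≤ (r + p * q) (+-mono-≤ h′ (*-monoˡ-≤ r h)))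
    where
    l : ∀ p q r → (r + p * q) + (q + p * r) ≡ suc p * (q + r)
    l = solve-∀
    rr : ∀ p q r e → (r + p * q) + ((p + e) + (q + e) * r) ≡ suc q * (p + r) + suc r * e
    rr = solve-∀

  Tri-DDU : ∀ {p q r e a b} → 1 ≤ p → 1 ≤ q → 1 ≤ r → suc a ≡ p + r → suc b ≡ q + r →
    suc e ≤ p + q → p ≤ q + e → q ≤ p + e → Tri (p * b) (q * a) (suc r * e)
  Tri-DDU {suc p} {suc q} {suc r} {e} _ _ _ refl refl (s≤s h) (s≤s h₁) (s≤s h₂) =
    DDU-step (suc r) h₁ h₂ , DDU-step (suc r) h₂ h₁ ,
    ≤-trans (*-monoʳ-≤ (suc (suc r)) h) (slack (r + 2 * (p * q)) (eq p q r))
    where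
    eq : ∀ p q r → suc (suc r) * (p + suc q) + (r + 2 * (p * q)) ≡ suc p * (q + suc r) + suc q * (p + suc r)
    eq = solve-∀

  Tri-SUU : ∀ {q r e} → Tri e q r → Tri (1 * e) (suc q * r) (suc r * q)
  Tri-SUU {q} {r} {e} (h₁ , h₂ , h₃) =
    subst (_≤ suc q * r + suc r * q) (≡-sym (*-identityˡ e)) (≤-trans h₁ (slack (2 * (q * r)) (eq q r))) ,
    subst (suc q * r ≤_) (eq′ q r e) (+-monoˡ-≤ (q * r) h₃) ,
    subst (suc r * q ≤_) (eq″ q r e) (+-monoˡ-≤ (r * q) h₂)
    where
    eq : ∀ q r → (q + r) + 2 * (q * r) ≡ suc q * r + suc r * q
    eq = solve-∀
    eq′ : ∀ q r e → (e + q) + q * r ≡ 1 * e + suc r * q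
    eq′ = solve-∀
    eq″ : ∀ q r e → (e + r) + r * q ≡ 1 * e + suc q * r
    eq″ = solve-∀

  Tri-SDU : ∀ {q r e} → 1 ≤ q → 1 ≤ r → suc e ≡ q + r → Tri (1 * e) (q * r) (suc r * q)
  Tri-SDU {suc q} {suc r} _ _ refl =
    slack (2 * (q * r) + 2 * q + r + 2) (eq₁ q r) ,
    slack (suc q + 1 * (q + suc r)) (eq₂ q r) ,
    slack r (eq₃ q r)
    where
    eq₁ : ∀ q r → 1 * (q + suc r) + (2 * (q * r) + 2 * q + r + 2) ≡ suc q * suc r + suc (suc r) * suc q
    eq₁ = solve-∀
    eq₂ : ∀ q r → suc q * suc r + (suc q + 1 * (q + suc r)) ≡ 1 * (q + suc r) + suc (suc r) * suc q
    eq₂ = solve-∀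
    eq₃ : ∀ q r → suc (suc r) * suc q + r ≡ 1 * (q + suc r) + suc q * suc r
    eq₃ = solve-∀

Quad : ∀ {k} → (Fin k → Fin k → ℕ) → Fin k → Fin k → Fin k → Fin k → Set
Quad d w x y z = Tri (d w x * d y z) (d w y * d x z) (d w z * d x y)

module _ {k} (d : Fin k → Fin k → ℕ) (d-sym : ∀ x y → d x y ≡ d y x) where

  Quad-swap₁₂ : ∀ {w x y z} → Quad d w x y z → Quad d x w y z
  Quad-swap₁₂ {w} {x} {y} {z} t =
    Tri-resp (cong (_* d y z) (d-sym w x)) (*-comm (d w z) (d x y)) (*-comm (d w y) (d x z)) (Tri-swap₂₃ t)

  Quad-swap₂₃ : ∀ {w x y z} → Quad d w x y z → Quad d w y x z
  Quad-swap₂₃ {w} {x} {y} {z} t = Tri-resp refl refl (cong (d w z *_) (d-sym x y)) (Tri-swap₁₂ t)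

  Quad-swap₃₄ : ∀ {w x y z} → Quad d w x y z → Quad d w x z y
  Quad-swap₃₄ {w} {x} {y} {z} t = Tri-resp (cong (d w x *_) (d-sym y z)) refl refl (Tri-swap₂₃ t)

  Quad-degenerate : (∀ x → d x x ≡ 0) → ∀ w y z → Quad d w w y z
  Quad-degenerate d0 w y z =
    Tri-swap₁₂ (Tri-swap₂₃ (Tri-degenerate (*-comm (d w y) (d w z)) (cong (_* d y z) (d0 w))))

Quad-extend : ∀ {k} (d : Fin (suc k) → Fin (suc k) → ℕ) → (∀ x y → d x y ≡ d y x) → (∀ x → d x x ≡ 0) →
  (∀ x y z → Quad d zero (suc x) (suc y) (suc z)) →
  (∀ w x y z → Quad d (suc w) (suc x) (suc y) (suc z)) →
  ∀ w x y z → Quad d w x y z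
Quad-extend d d-sym d0 new old = all
  where
  first : ∀ x y z → Quad d zero x y z
  first zero    y       z       = Quad-degenerate d d-sym d0 zero y z
  first (suc x) zero    z       = Quad-swap₂₃ d d-sym (Quad-degenerate d d-sym d0 zero (suc x) z)
  first (suc x) (suc y) zero    = Quad-swap₃₄ d d-sym (Quad-swap₂₃ d d-sym (Quad-degenerate d d-sym d0 zero (suc x) (suc y)))
  first (suc x) (suc y) (suc z) = new x y z
  all : ∀ w x y z → Quad d w x y z
  all zero    x       y       z       = first x y z
  all (suc w) zero    y       z       = Quad-swap₁₂ d d-sym (first (suc w) y z)
  all (suc w) (suc x) zero    z       = Quad-swap₂₃ d d-sym (Quad-swap₁₂ d d-sym (first (suc w) (suc x) z))
  all (suc w) (suc x) (suc y) zero    =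
    Quad-swap₃₄ d d-sym (Quad-swap₂₃ d d-sym (Quad-swap₁₂ d d-sym (first (suc w) (suc x) (suc y))))
  all (suc w) (suc x) (suc y) (suc z) = old w x y z

module PtolemyStep {k} {d : Fin k → Fin k → ℕ} {dn : Fin k → Fin k → Bool} (M : TreeMetric d dn) (s : Fin k) where

  open TreeMetric M

  d-Tri : ∀ x y z → Tri (d y z) (d x y) (d x z)
  d-Tri x y z =
    ≤-trans (δ-tri y x z) (≤-reflexive (cong (_+ d x z) (δ-sym y x))) ,
    ≤-trans (δ-tri x z y) (≤-reflexive (≡-trans (+-comm (d x z) (d z y)) (cong (_+ d x z) (δ-sym z y)))) ,
    ≤-trans (δ-tri x y z) (≤-reflexive (+-comm (d x y) (d y z)))

  down⇒≢ : ∀ {x} → dn s x ≡ true → s ≢ x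
  down⇒≢ h refl with ≡-trans (≡-sym h) (down-diag s)
  ... | ()

  data Position (x : Fin k) : Set where
    at    : s ≡ x → Position x
    below : dn s x ≡ true → Position x
    above : dn s x ≡ false → s ≢ x → Position x

  position : ∀ x → Position x
  position x with s ≟F x
  ... | yes p = at p
  ... | no p with dn s x in eq
  ...   | true  = below eq
  ...   | false = above eq p

  New : (Fin k → ℕ) → Fin k → Fin k → Fin k → Set
  New t x y z = Tri (t x * d y z) (t y * d x z) (t z * d x y)

  New-swap₁₂ : ∀ t x y z → New t x y z → New t y x z
  New-swap₁₂ t x y z h = Tri-resp refl refl (cong (t z *_) (δ-sym x y)) (Tri-swap₁₂ h)

  New-swap₂₃ : ∀ t x y z → New t x y z → New t x z y
  New-swap₂₃ t x y z h = Tri-resp (cong (t x *_) (δ-sym y z)) refl refl (Tri-swap₂₃ h)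

  private
    degenerate : ∀ (t : Fin k → ℕ) z → New t s s z
    degenerate t z = Tri-degenerate refl (≡-trans (cong (t z *_) (δ-diag s)) (*-zeroʳ (t z)))

  module ChildStep where

    t : Fin k → ℕ
    t = childδ d s

    t-at : t s ≡ 1
    t-at = cong (1 ⊔_) (δ-diag s)

    t-off : ∀ {x} → s ≢ x → t x ≡ d s x
    t-off p = m≤n⇒m⊔n≡n (δ-pos p)

    private
      at-s : ∀ y z → New t s y z
      at-s y z with s ≟F y | s ≟F z
      ... | yes refl | _        = degenerate t z
      ... | no _     | yes refl = New-swap₂₃ t s s y (degenerate t y)
      ... | no p     | no q     =
        Tri-resp (cong (_* d y z) (≡-sym t-at)) (cong (_* d s z) (≡-sym (t-off p))) (cong (_* d s y) (≡-sym (t-off q)))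
          (Tri-twin (d s y) (d s z) (δ-pos p) (δ-pos q) (proj₁ (d-Tri s y z)))

    new : ∀ x y z → New t x y z
    new x y z with s ≟F x | s ≟F y | s ≟F z
    ... | yes refl | _        | _        = at-s y z
    ... | no _     | yes refl | _        = New-swap₁₂ t s x z (at-s x z)
    ... | no _     | no _     | yes refl = New-swap₂₃ t x s y (New-swap₁₂ t s x y (at-s x y))
    ... | no p     | no q     | no r     =
      Tri-resp (cong (_* d y z) (≡-sym (t-off p))) (cong (_* d x z) (≡-sym (t-off q))) (cong (_* d x y) (≡-sym (t-off r)))
        (ptolemy s x y z)

  module ParentStep where

    t : Fin k → ℕ
    t = parentδ d dn s

    t-below : ∀ {x} → dn s x ≡ true → t x ≡ d s x
    t-below h rewrite h = refl

    t-above : ∀ {x} → dn s x ≡ false → t x ≡ suc (d s x)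
    t-above h rewrite h = refl

    t-at : t s ≡ 1
    t-at = ≡-trans (t-above (down-diag s)) (cong suc (δ-diag s))

    private
      at-s : ∀ {y z} → Position y → Position z → New t s y z
      at-s (at refl) _ = degenerate t _
      at-s {y} _ (at refl) = New-swap₂₃ t s s y (degenerate t y)
      at-s {y} {z} (below p) (below q) =
        Tri-resp (cong (_* d y z) (≡-sym t-at)) (cong (_* d s z) (≡-sym (t-below p))) (cong (_* d s y) (≡-sym (t-below q)))
          (Tri-twin (d s y) (d s z) (δ-pos (down⇒≢ p)) (δ-pos (down⇒≢ q)) (proj₁ (d-Tri s y z)))
      at-s {y} {z} (below p) (above q q≢) =
        Tri-resp (cong (_* d y z) (≡-sym t-at)) (cong (_* d s z) (≡-sym (t-below p))) (cong (_* d s y) (≡-sym (t-above q)))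
          (Tri-SDU (δ-pos (down⇒≢ p)) (δ-pos q≢) (down-up p q (λ e → q≢ (≡-sym e))))
      at-s {y} {z} (above p p≢) (below q) = New-swap₂₃ t s z y (at-s (below q) (above p p≢))
      at-s {y} {z} (above p _) (above q _) =
        Tri-resp (cong (_* d y z) (≡-sym t-at)) (cong (_* d s z) (≡-sym (t-above p))) (cong (_* d s y) (≡-sym (t-above q)))
          (Tri-SUU (d-Tri s y z))

      duu : ∀ {x y z} → dn s x ≡ true → dn s y ≡ false → s ≢ y → dn s z ≡ false → s ≢ z → New t x y z
      duu {x} {y} {z} p q q≢ r r≢ =
        Tri-resp (cong (_* d y z) (≡-sym (t-below p))) (cong (_* d x z) (≡-sym (t-above q))) (cong (_* d x y) (≡-sym (t-above r)))
          (Tri-DUU (δ-pos (down⇒≢ p)) (down-up p q (λ e → q≢ (≡-sym e))) (down-up p r (λ e → r≢ (≡-sym e))) (d-Tri s y z))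

      ddu : ∀ {x y z} → dn s x ≡ true → dn s y ≡ true → dn s z ≡ false → s ≢ z → New t x y z
      ddu {x} {y} {z} p q r r≢ =
        Tri-resp (cong (_* d y z) (≡-sym (t-below p))) (cong (_* d x z) (≡-sym (t-below q))) (cong (_* d x y) (≡-sym (t-above r)))
          (Tri-DDU (δ-pos (down⇒≢ p)) (δ-pos (down⇒≢ q)) (δ-pos r≢)
            (down-up p r (λ e → r≢ (≡-sym e))) (down-up q r (λ e → r≢ (≡-sym e))) (down-down p q)
            (≤-trans (δ-tri s y x) (≤-reflexive (cong (d s y +_) (δ-sym y x)))) (δ-tri s x y))

      off-s : ∀ {x y z} → Position x → Position y → Position z → New t x y z
      off-s (at refl) Y Z = at-s Y Z
      off-s {x} {_} {z} X (at refl) Z = New-swap₁₂ t s x z (at-s X Z)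
      off-s {x} {y} X Y (at refl) = New-swap₂₃ t x s y (New-swap₁₂ t s x y (at-s X Y))
      off-s {x} {y} {z} (below p) (below q) (below r) =
        Tri-resp (cong (_* d y z) (≡-sym (t-below p))) (cong (_* d x z) (≡-sym (t-below q))) (cong (_* d x y) (≡-sym (t-below r)))
          (ptolemy s x y z)
      off-s (below p) (below q) (above r r≢) = ddu p q r r≢
      off-s {x} {y} {z} (below p) (above q q≢) (below r) = New-swap₂₃ t x z y (ddu p r q q≢)
      off-s {x} {y} {z} (above p p≢) (below q) (below r) = New-swap₁₂ t y x z (New-swap₂₃ t y z x (ddu q r p p≢))
      off-s (below p) (above q q≢) (above r r≢) = duu p q q≢ r r≢
      off-s {x} {y} {z} (above p p≢) (below q) (above r r≢) = New-swap₁₂ t y x z (duu q p p≢ r r≢)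
      off-s {x} {y} {z} (above p p≢) (above q q≢) (below r) = New-swap₂₃ t x z y (New-swap₁₂ t z x y (duu r p p≢ q q≢))
      off-s {x} {y} {z} (above p _) (above q _) (above r _) =
        Tri-resp (cong (_* d y z) (≡-sym (t-above p))) (cong (_* d x z) (≡-sym (t-above q))) (cong (_* d x y) (≡-sym (t-above r)))
          (Tri-+ (Tri-swap₂₃ (d-Tri x y z)) (ptolemy s x y z))

    new : ∀ x y z → New t x y z
    new x y z = off-s (position x) (position y) (position z)

module Extend {k} {d : Fin k → Fin k → ℕ} {dn : Fin k → Fin k → Bool} (M : TreeMetric d dn)
  (t : Fin k → ℕ) (out : Bool) (inn : Fin k → Bool) where

  open TreeMetric M

  private
    D : Fin (suc k) → Fin (suc k) → ℕ
    D = extendδ d t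
    Dn : Fin (suc k) → Fin (suc k) → Bool
    Dn = extendDown dn out inn

  extend-metric :
    (∀ x → 1 ≤ t x) →
    (∀ y z → t z ≤ t y + d y z) →
    (∀ x z → d x z ≤ t x + t z) →
    (out ≡ true → ∀ x y → suc (d x y) ≤ t x + t y) →
    (∀ p y → inn p ≡ true → dn p y ≡ false → y ≢ p → suc (t y) ≡ t p + d p y × inn y ≡ dn y p) →
    (∀ p x → dn p x ≡ true → inn p ≡ false → suc (t x) ≡ d p x + t p × inn x ≡ dn x p) →
    (∀ p y → inn p ≡ true → dn p y ≡ true → suc (t y) ≤ t p + d p y) →
    (out ≡ true → ∀ y → inn y ≡ true → 2 ≤ t y) →
    (∀ x y z → Tri (t x * d y z) (t y * d x z) (t z * d x y)) →
    TreeMetric D Dn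
  extend-metric t-pos t-tri d≤tt out-out in-up down-out in-down in-out new = record
    { δ-diag = diag ; δ-sym = symm ; δ-pos = pos ; δ-tri = tri ; down-diag = ddiag
    ; down-up = λ {s} {x} {y} → du {s} {x} {y} ; down-down = λ {s} {x} {y} → dd {s} {x} {y}
    ; down-sep = λ {s} {x} {y} → sep {s} {x} {y} ; down-both = λ {x} {y} → both {x} {y}
    ; ptolemy = Quad-extend D symm diag new ptolemy }
    where
    diag : ∀ x → D x x ≡ 0
    diag zero    = refl
    diag (suc x) = δ-diag x

    symm : ∀ x y → D x y ≡ D y x
    symm zero    zero    = refl
    symm zero    (suc y) = refl
    symm (suc x) zero    = refl
    symm (suc x) (suc y) = δ-sym x y

    pos : ∀ {x y} → x ≢ y → 1 ≤ D x y
    pos {zero}  {zero}  h = ⊥-elim (h refl)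
    pos {zero}  {suc y} h = t-pos y
    pos {suc x} {zero}  h = t-pos x
    pos {suc x} {suc y} h = δ-pos (λ e → h (cong suc e))

    tri : ∀ x y z → D x z ≤ D x y + D y z
    tri zero    zero    z       = ≤-refl
    tri zero    (suc y) zero    = z≤n
    tri zero    (suc y) (suc z) = t-tri y z
    tri (suc x) zero    zero    = m≤m+n _ 0
    tri (suc x) zero    (suc z) = d≤tt x z
    tri (suc x) (suc y) zero    =
      ≤-trans (t-tri y x) (≤-reflexive (≡-trans (+-comm (t y) (d y x)) (cong (_+ t y) (δ-sym y x))))
    tri (suc x) (suc y) (suc z) = δ-tri x y z

    ddiag : ∀ x → Dn x x ≡ false
    ddiag zero    = refl
    ddiag (suc x) = down-diag x

    du : ∀ {s x y} → Dn s x ≡ true → Dn s y ≡ false → y ≢ s → suc (D x y) ≡ D s x + D s y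
    du {zero}  {suc x} {zero}  h h′ n = ⊥-elim (n refl)
    du {zero}  {suc x} {suc y} h h′ n = ⊥-elim (true≢false h h′)
    du {suc p} {zero}  {zero}  h h′ n = ⊥-elim (true≢false h h′)
    du {suc p} {zero}  {suc y} h h′ n = proj₁ (in-up p y h h′ (λ e → n (cong suc e)))
    du {suc p} {suc x} {zero}  h h′ n = proj₁ (down-out p x h h′)
    du {suc p} {suc x} {suc y} h h′ n = down-up h h′ (λ e → n (cong suc e))

    dd : ∀ {s x y} → Dn s x ≡ true → Dn s y ≡ true → suc (D x y) ≤ D s x + D s y
    dd {zero}  {suc x} {suc y} h h′ = out-out h x y
    dd {suc p} {zero}  {zero}  h h′ = ≤-trans (t-pos p) (m≤m+n _ _)
    dd {suc p} {zero}  {suc y} h h′ = in-down p y h h′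
    dd {suc p} {suc x} {zero}  h h′ = ≤-trans (in-down p x h′ h) (≤-reflexive (+-comm (t p) (d p x)))
    dd {suc p} {suc x} {suc y} h h′ = down-down h h′

    sep : ∀ {s x y} → Dn s x ≡ true → Dn s y ≡ false → y ≢ s → Dn x y ≡ Dn x s × Dn y x ≡ Dn y s
    sep {zero}  {suc x} {zero}  h h′ n = ⊥-elim (n refl)
    sep {zero}  {suc x} {suc y} h h′ n = ⊥-elim (true≢false h h′)
    sep {suc p} {zero}  {zero}  h h′ n = ⊥-elim (true≢false h h′)
    sep {suc p} {zero}  {suc y} h h′ n = refl , proj₂ (in-up p y h h′ (λ e → n (cong suc e)))
    sep {suc p} {suc x} {zero}  h h′ n = proj₂ (down-out p x h h′) , refl
    sep {suc p} {suc x} {suc y} h h′ n = down-sep h h′ (λ e → n (cong suc e))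

    both : ∀ {x y} → Dn x y ≡ true → Dn y x ≡ true → 2 ≤ D x y
    both {zero}  {suc y} h h′ = in-out h y h′
    both {suc x} {zero}  h h′ = in-out h′ x h
    both {suc x} {suc y} h h′ = down-both h h′

module _ {k} {d : Fin k → Fin k → ℕ} {dn : Fin k → Fin k → Bool} (M : TreeMetric d dn) (s : Fin k) where

  open TreeMetric M
  open PtolemyStep M s

  child-metric : TreeMetric (extendδ d (childδ d s)) (extendDown dn false (childIn dn s))
  child-metric = Extend.extend-metric M t false (childIn dn s) (λ x → m≤m⊔n 1 (d s x)) t-tri d≤tt
    (λ ()) in-up down-out in-down (λ ()) new
    where
    open ChildStep

    d≤t : ∀ x → d s x ≤ t x
    d≤t x = m≤n⊔m 1 (d s x)

    t-tri : ∀ y z → t z ≤ t y + d y z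
    t-tri y z = ⊔-lub (≤-trans (m≤m⊔n 1 (d s y)) (m≤m+n _ _))
                      (≤-trans (δ-tri s y z) (+-monoˡ-≤ (d y z) (d≤t y)))

    d≤tt : ∀ x z → d x z ≤ t x + t z
    d≤tt x z = ≤-trans (δ-tri x s z) (+-mono-≤ (≤-trans (≤-reflexive (δ-sym x s)) (d≤t x)) (d≤t z))

    in-up : ∀ p y → childIn dn s p ≡ true → dn p y ≡ false → y ≢ p →
      suc (t y) ≡ t p + d p y × childIn dn s y ≡ dn y p
    in-up p y h h′ y≢p with p ≟F s | y ≟F s
    ... | yes refl | yes refl = ⊥-elim (y≢p refl)
    ... | yes refl | no y≢s   =
      ≡-trans (cong suc (t-off (λ e → y≢s (≡-sym e)))) (cong (_+ d s y) (≡-sym t-at)) , refl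
    ... | no p≢s   | yes refl = ⊥-elim (true≢false h h′)
    ... | no p≢s   | no y≢s   =
      ≡-trans (cong suc (t-off (λ e → y≢s (≡-sym e))))
        (≡-trans (down-up h h′ y≢p)
          (cong (_+ d p y) (≡-trans (δ-sym p s) (≡-sym (t-off (λ e → p≢s (≡-sym e))))))) ,
      proj₂ (down-sep h h′ y≢p)

    down-out : ∀ p x → dn p x ≡ true → childIn dn s p ≡ false →
      suc (t x) ≡ d p x + t p × childIn dn s x ≡ dn x p
    down-out p x h h′ with p ≟F s | x ≟F s
    ... | yes refl | _        = ⊥-elim (true≢false refl h′)
    ... | no p≢s   | yes refl = ⊥-elim (true≢false h h′)
    ... | no p≢s   | no x≢s   =
      ≡-trans (cong suc (≡-trans (t-off (λ e → x≢s (≡-sym e))) (δ-sym s x)))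
        (≡-trans (down-up h h′ (λ e → p≢s (≡-sym e)))
          (cong (d p x +_) (≡-trans (δ-sym p s) (≡-sym (t-off (λ e → p≢s (≡-sym e))))))) ,
      proj₁ (down-sep h h′ (λ e → p≢s (≡-sym e)))

    in-down : ∀ p y → childIn dn s p ≡ true → dn p y ≡ true → suc (t y) ≤ t p + d p y
    in-down p y h h′ with p ≟F s | y ≟F s
    ... | yes refl | _        =
      ≤-reflexive (≡-trans (cong suc (t-off (down⇒≢ h′))) (cong (_+ d s y) (≡-sym t-at)))
    ... | no p≢s   | yes refl =
      subst (λ z → suc z ≤ t p + d p s) (≡-sym t-at) (+-mono-≤ (m≤m⊔n 1 (d s p)) (δ-pos p≢s))
    ... | no p≢s   | no y≢s   =
      subst₂ _≤_ (cong suc (≡-sym (t-off (λ e → y≢s (≡-sym e)))))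
        (cong (_+ d p y) (≡-trans (δ-sym p s) (≡-sym (t-off (λ e → p≢s (≡-sym e))))))
        (down-down h h′)

  parent-metric : TreeMetric (extendδ d (parentδ d dn s)) (extendDown dn true (λ i → dn i s))
  parent-metric = Extend.extend-metric M t true (λ i → dn i s) t-pos t-tri d≤tt
    (λ _ → out-out) in-up down-out in-down (λ _ → in-out) new
    where
    open ParentStep

    d≤t : ∀ x → d s x ≤ t x
    d≤t x with dn s x
    ... | true  = ≤-refl
    ... | false = n≤1+n _

    t-pos : ∀ x → 1 ≤ t x
    t-pos x with dn s x in e
    ... | true  = δ-pos (down⇒≢ e)
    ... | false = s≤s z≤n

    t-tri : ∀ y z → t z ≤ t y + d y z
    t-tri y z with dn s z in ez
    ... | true  = ≤-trans (δ-tri s y z) (+-monoˡ-≤ (d y z) (d≤t y))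
    ... | false with dn s y in ey
    ...   | false = s≤s (δ-tri s y z)
    ...   | true with z ≟F s
    ...     | yes refl = ≤-trans (≤-reflexive (cong suc (δ-diag s))) (≤-trans (δ-pos (down⇒≢ ey)) (m≤m+n _ _))
    ...     | no z≢s   = +-mono-≤ (δ-pos (down⇒≢ ey)) (go (δ-pos (down⇒≢ ey)) (down-up ey ez z≢s))
      where
      go : ∀ {a b c} → 1 ≤ a → suc b ≡ a + c → c ≤ b
      go {suc a} _ refl = m≤n+m _ a

    d≤tt : ∀ x z → d x z ≤ t x + t z
    d≤tt x z = ≤-trans (δ-tri x s z) (+-mono-≤ (≤-trans (≤-reflexive (δ-sym x s)) (d≤t x)) (d≤t z))

    mixed : ∀ x y → dn s x ≡ true → dn s y ≡ false → suc (d x y) ≤ d s x + suc (d s y)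
    mixed x y ex ey with y ≟F s
    ... | yes refl = ≤-reflexive (≡-trans (cong suc (δ-sym x s))
                       (≡-trans (+-comm 1 (d s x)) (cong (λ z → d s x + suc z) (≡-sym (δ-diag s)))))
    ... | no y≢s   = ≤-trans (≤-reflexive (down-up ex ey y≢s)) (+-monoʳ-≤ (d s x) (n≤1+n _))

    out-out : ∀ x y → suc (d x y) ≤ t x + t y
    out-out x y with dn s x in ex | dn s y in ey
    ... | true  | true  = down-down ex ey
    ... | true  | false = mixed x y ex ey
    ... | false | true  =
      ≤-trans (≤-reflexive (cong suc (δ-sym x y)))
        (≤-trans (mixed y x ey ex) (≤-reflexive (+-comm (d s y) (suc (d s x)))))
    ... | false | false =
      s≤s (≤-trans (δ-tri x s y) (+-mono-≤ (≤-reflexive (δ-sym x s)) (n≤1+n _)))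

    in-up : ∀ p y → dn p s ≡ true → dn p y ≡ false → y ≢ p → suc (t y) ≡ t p + d p y × dn y s ≡ dn y p
    in-up p y h h′ y≢p = eq , proj₂ (down-sep h h′ y≢p)
      where
      eq : suc (t y) ≡ t p + d p y
      eq with dn s y | dn s p | proj₁ (down-sep h h′ y≢p)
      ... | true  | true  | _ = ≡-trans (down-up h h′ y≢p) (cong (_+ d p y) (δ-sym p s))
      ... | false | false | _ = cong suc (≡-trans (down-up h h′ y≢p) (cong (_+ d p y) (δ-sym p s)))

    down-out : ∀ p x → dn p x ≡ true → dn p s ≡ false → suc (t x) ≡ d p x + t p × dn x s ≡ dn x p
    down-out p x h h′ with s ≟F p
    ... | yes refl = ≡-trans (cong suc (t-below h)) (≡-trans (+-comm 1 (d s x)) (cong (d s x +_) (≡-sym t-at))) , refl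
    ... | no s≢p   = eq , proj₁ (down-sep h h′ s≢p)
      where
      eq : suc (t x) ≡ d p x + t p
      eq with dn s x | dn s p | proj₂ (down-sep h h′ s≢p)
      ... | true  | true  | _ =
        ≡-trans (cong suc (δ-sym s x)) (≡-trans (down-up h h′ s≢p) (cong (d p x +_) (δ-sym p s)))
      ... | false | false | _ =
        ≡-trans (cong suc (≡-trans (cong suc (δ-sym s x)) (≡-trans (down-up h h′ s≢p) (cong (d p x +_) (δ-sym p s)))))
                (≡-sym (+-suc (d p x) (d s p)))

    in-down : ∀ p y → dn p s ≡ true → dn p y ≡ true → suc (t y) ≤ t p + d p y
    in-down p y h h′ with dn s y in ey
    ... | true  = ≤-trans (down-down h h′) (+-monoˡ-≤ (d p y) (≤-trans (≤-reflexive (δ-sym p s)) (d≤t p)))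
    ... | false with dn s p in ep
    ...   | false = s≤s (≤-trans (down-down h h′) (+-monoˡ-≤ (d p y) (≤-reflexive (δ-sym p s))))
    ...   | true with y ≟F s
    ...     | yes refl =
      ≤-trans (≤-reflexive (cong (λ z → suc (suc z)) (δ-diag s))) (≤-trans (down-both ep h) (m≤m+n _ _))
    ...     | no y≢s   = +-mono-≤ (down-both ep h) (go (δ-pos (down⇒≢ ep)) (down-up ep ey y≢s))
      where
      go : ∀ {a b c} → 1 ≤ a → suc b ≡ a + c → c ≤ b
      go {suc a} _ refl = m≤n+m _ a

    in-out : ∀ y → dn y s ≡ true → 2 ≤ t y
    in-out y h with dn s y in ey
    ... | true  = down-both ey h
    ... | false = s≤s (δ-pos (λ { refl → true≢false h ey }))

module _ {V : Set} where

  δ-metric : ∀ {k} (T : OTree V k) → TreeMetric (δ T) (down T)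
  δ-metric (single v) = record
    { δ-diag = λ _ → refl ; δ-sym = λ _ _ → refl ; δ-pos = λ { {zero} {zero} n → ⊥-elim (n refl) }
    ; δ-tri = λ _ _ _ → z≤n ; down-diag = λ _ → refl ; down-up = λ () ; down-down = λ ()
    ; down-sep = λ () ; down-both = λ () ; ptolemy = λ _ _ _ _ → z≤n , z≤n , z≤n }
  δ-metric (addChild T s v)  = child-metric (δ-metric T) s
  δ-metric (addParent T s v) = parent-metric (δ-metric T) s

-- Arboreal networks represent Ptolemaic graphs

Reach-trans : ∀ {m} {arc : Fin m → Fin m → Bool} {u v w} → Reach arc u v → Reach arc v w → Reach arc u w
Reach-trans rnil        q = q
Reach-trans (rcons a p) q = rcons a (Reach-trans p q)

countF-≥1 : ∀ {m} (f : Fin m → Bool) i → f i ≡ true → 1 ≤ countF f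
countF-≥1 f zero    e rewrite e = s≤s z≤n
countF-≥1 f (suc i) e = ≤-trans (countF-≥1 (λ j → f (suc j)) i e) (m≤n+m _ _)

countF-witness : ∀ {m} (f : Fin m → Bool) → 1 ≤ countF f → ∃[ i ] f i ≡ true
countF-witness {zero}  f ()
countF-witness {suc m} f h with f zero in e
... | true  = zero , e
... | false with countF-witness (λ j → f (suc j)) h
...   | i , q = suc i , q

module Growth {m} (arc : Fin m → Fin m → Bool)
  (no-loop : ∀ v → arc v v ≡ false) (no-2-cycle : ∀ {u v} → arc u v ≡ true → arc v u ≡ true → ⊥) where

  A : Fin m → Fin m → Set
  A u v = arc u v ≡ true

  Sound : ∀ {k} → OTree (Fin m) k → Set
  Sound (single v)        = ⊤
  Sound (addChild T s v)  = A (label T s) v × Sound T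
  Sound (addParent T s v) = A v (label T s) × Sound T

  Complete : ∀ {k} → OTree (Fin m) k → Set
  Complete T = ∀ i j → A (label T i) (label T j) → TArc T i j

  LabelInjective : ∀ {k} → OTree (Fin m) k → Set
  LabelInjective T = ∀ i j → label T i ≡ label T j → i ≡ j

  Grown : ℕ → Set
  Grown k = Σ (OTree (Fin m) k) λ T → Sound T × Complete T × LabelInjective T

  Im : ∀ {k} → OTree (Fin m) k → Fin m → Set
  Im T v = ∃[ i ] label T i ≡ v

  Inside : ∀ {k} → OTree (Fin m) k → Fin m → Fin m → Set
  Inside T u v = Und A u v × Im T u × Im T v

  inside-walk : ∀ {k} (T : OTree (Fin m) k) → Sound T → ∀ i j → UWalk (Inside T) (label T i) (label T j)
  inside-walk (single v) _ i j = unil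
  inside-walk (addChild T s v) (a , S) = go
    where
    lift : ∀ {u w} → UWalk (Inside T) u w → UWalk (Inside (addChild T s v)) u w
    lift = UWalk-map (λ (e , (i , p) , (j , q)) → e , (suc i , p) , (suc j , q))
    go : ∀ i j → UWalk (Inside (addChild T s v)) (label (addChild T s v) i) (label (addChild T s v) j)
    go zero    zero    = unil
    go zero    (suc j) = ucons (inj₂ a , (zero , refl) , (suc s , refl)) (lift (inside-walk T S s j))
    go (suc i) zero    = lift (inside-walk T S i s) ++ᵤ ucons (inj₁ a , (suc s , refl) , (zero , refl)) unil
    go (suc i) (suc j) = lift (inside-walk T S i j)
  inside-walk (addParent T s v) (a , S) = go
    where
    lift : ∀ {u w} → UWalk (Inside T) u w → UWalk (Inside (addParent T s v)) u w
    lift = UWalk-map (λ (e , (i , p) , (j , q)) → e , (suc i , p) , (suc j , q))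
    go : ∀ i j → UWalk (Inside (addParent T s v)) (label (addParent T s v) i) (label (addParent T s v) j)
    go zero    zero    = unil
    go zero    (suc j) = ucons (inj₁ a , (zero , refl) , (suc s , refl)) (lift (inside-walk T S s j))
    go (suc i) zero    = lift (inside-walk T S i s) ++ᵤ ucons (inj₂ a , (suc s , refl) , (zero , refl)) unil
    go (suc i) (suc j) = lift (inside-walk T S i j)

  module _ (ac : UAcyclic (λ _ → ⊤) (Und A)) where

    attach-unique : ∀ {k} (T : OTree (Fin m) k) → Sound T → LabelInjective T →
      ∀ {t} → ¬ Im T t → ∀ s → Und A (label T s) t → ∀ i → Und A (label T i) t → i ≡ s
    attach-unique T S inj {t} ¬im s es i ei with i ≟F s
    ... | yes p  = p
    ... | no i≢s = ⊥-elim (acyclic⇒bridge (λ _ → tt , tt) _≟F_ ac (Und-sym {A = A} ei) (λ e → ¬im (i , ≡-sym e)) detour)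
      where
      detour : UWalk (Cut (Und A) t (label T i)) (label T i) t
      detour = UWalk-map (λ (e , iu , iv) → e , (λ { (refl , _) → ¬im iu }) , (λ { (_ , refl) → ¬im iv }))
                         (inside-walk T S i s)
               ++ᵤ ucons (es , (λ (e , _) → ¬im (s , e)) , (λ (e , _) → i≢s (≡-sym (inj s i e)))) unil

    grow-step : ∀ {k} → (g : Grown k) → ∀ {t} → ¬ Im (proj₁ g) t → ∀ s → Und A (label (proj₁ g) s) t → Grown (suc k)
    grow-step (T , S , C , inj) {t} ¬im s e@(inj₁ a) = addChild T s t , (a , S) , complete , injective
      where
      complete : Complete (addChild T s t)
      complete zero    zero    h = true≢false h (no-loop t)
      complete zero    (suc j) h with attach-unique T S inj ¬im s e j (inj₂ h)
      ... | refl = no-2-cycle a h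
      complete (suc i) zero    h = attach-unique T S inj ¬im s e i (inj₁ h)
      complete (suc i) (suc j) h = C i j h
      injective : LabelInjective (addChild T s t)
      injective zero    zero    _ = refl
      injective zero    (suc j) h = ⊥-elim (¬im (j , ≡-sym h))
      injective (suc i) zero    h = ⊥-elim (¬im (i , h))
      injective (suc i) (suc j) h = cong suc (inj i j h)
    grow-step (T , S , C , inj) {t} ¬im s e@(inj₂ a) = addParent T s t , (a , S) , complete , injective
      where
      complete : Complete (addParent T s t)
      complete zero    zero    h = true≢false h (no-loop t)
      complete zero    (suc j) h = attach-unique T S inj ¬im s e j (inj₂ h)
      complete (suc i) zero    h with attach-unique T S inj ¬im s e i (inj₁ h)
      ... | refl = no-2-cycle h a
      complete (suc i) (suc j) h = C i j h
      injective : LabelInjective (addParent T s t)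
      injective zero    zero    _ = refl
      injective zero    (suc j) h = ⊥-elim (¬im (j , ≡-sym h))
      injective (suc i) zero    h = ⊥-elim (¬im (i , h))
      injective (suc i) (suc j) h = cong suc (inj i j h)

    im? : ∀ {k} (T : OTree (Fin m) k) v → Dec (Im T v)
    im? T v = any? (λ i → label T i ≟F v)

    grow : UConnected (λ _ → ⊤) (Und A) → ∀ f {k} → Grown (suc k) → m < suc k + f →
      ∃[ k′ ] Σ (Grown k′) λ g → ∀ v → Im (proj₁ g) v
    grow con f {k} g@(T , S , C , inj) lt with all? (im? T)
    ... | yes all = suc k , g , all
    grow con zero    {k} g@(T , S , C , inj) lt | no ¬all =
      ⊥-elim (<⇒≱ lt (≤-trans (≤-reflexive (+-identityʳ (suc k))) (injective⇒≤ (λ {i} {j} → inj i j))))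
    grow con (suc f) {k} g@(T , S , C , inj) lt | no ¬all
      with ¬∀⟶∃¬ m (Im T) (im? T) ¬all
    ... | v , ¬im with crossing (im? T) (con (label T zero) v tt tt) (zero , refl) ¬im
    ... | _ , t , e , (s , refl) , ¬imt =
      grow con f (grow-step g ¬imt s e) (subst (m <_) (+-suc (suc k) f) lt)

    spanning : UConnected (λ _ → ⊤) (Und A) → Fin m → ∃[ k ] Σ (Grown k) λ g → ∀ v → Im (proj₁ g) v
    spanning con v = grow con m {0} (single v , tt , (λ { zero zero h → true≢false h (no-loop v) }) , (λ { zero zero _ → refl })) ≤-refl

TArc-δ : ∀ {V k} (T : OTree V k) i j → TArc T i j → δ T i j ≡ 1 × down T i j ≡ true × down T j i ≡ false
TArc-δ (addChild T s v) (suc i) zero refl with i ≟F i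
... | yes _ = cong (1 ⊔_) (TreeMetric.δ-diag (δ-metric T) i) , refl , refl
... | no n  = ⊥-elim (n refl)
TArc-δ (addChild T s v) (suc i) (suc j) h = TArc-δ T i j h
TArc-δ (addParent T s v) zero (suc j) refl =
  PtolemyStep.ParentStep.t-at (δ-metric T) s , refl , TreeMetric.down-diag (δ-metric T) s
TArc-δ (addParent T s v) (suc i) (suc j) h = TArc-δ T i j h

module TreeDistance {m} (arc : Fin m → Fin m → Bool)
  (no-loop : ∀ v → arc v v ≡ false) (no-2-cycle : ∀ {u v} → arc u v ≡ true → arc v u ≡ true → ⊥) where

  open Growth arc no-loop no-2-cycle

  SharedAnc : Fin m → Fin m → Set
  SharedAnc u v = ∃[ a ] (Reach arc a u × Reach arc a v)

  data SWalk : Fin m → Fin m → ℕ → Set where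
    snil  : ∀ {u} → SWalk u u 0
    scons : ∀ {u w v k} → SharedAnc u w → SWalk w v k → SWalk u v (suc k)

  SWalk-snoc : ∀ {u v w k} → SWalk u v k → SharedAnc v w → SWalk u w (suc k)
  SWalk-snoc snil        a = scons a snil
  SWalk-snoc (scons b p) a = scons b (SWalk-snoc p a)

  SWalk-sym : ∀ {u v k} → SWalk u v k → SWalk v u k
  SWalk-sym snil                  = snil
  SWalk-sym (scons (a , p , q) w) = SWalk-snoc (SWalk-sym w) (a , q , p)

  -- Walks of shared ancestries realising δ: an end that is left downwards is first replaced by one
  -- of its descendants.
  Start : Bool → Fin m → Fin m → Set
  Start true  u w = Reach arc u w
  Start false u w = u ≡ w

  bit : Bool → ℕ
  bit b = if b then 1 else 0

  Realised : ∀ {k} → OTree (Fin m) k → Fin k → Fin k → Set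
  Realised T i j = ∃[ w ] ∃[ w′ ] ∃[ l ]
    (Start (down T i j) (label T i) w × SWalk w w′ l × Start (down T j i) (label T j) w′ ×
     δ T i j ≡ bit (down T i j) + (l + bit (down T j i)))

  Realised-sym : ∀ {k} (T : OTree (Fin m) k) i j → Realised T i j → Realised T j i
  Realised-sym T i j (w , w′ , l , p , q , r , e) =
    w′ , w , l , r , SWalk-sym q , p ,
    ≡-trans (TreeMetric.δ-sym (δ-metric T) j i) (≡-trans e (exch (bit (down T i j)) l (bit (down T j i))))
    where
    exch : ∀ a b c → a + (b + c) ≡ c + (b + a)
    exch a b c = ≡-trans (+-comm a (b + c)) (≡-trans (cong (_+ a) (+-comm b c)) (+-assoc c b a))

  private
    child-realised : ∀ b b′ {a v x w w′ l δ} → A a v → 1 ≤ δ →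
      Start b a w → SWalk w w′ l → Start b′ x w′ → δ ≡ bit b + (l + bit b′) →
      ∃[ u ] ∃[ u′ ] ∃[ l′ ] (v ≡ u × SWalk u u′ l′ × Start b′ x u′ × 1 ⊔ δ ≡ l′ + bit b′)
    child-realised true b′ {a} {v} {w′ = w′} {l} av 1≤ p q r e =
      v , w′ , suc l , refl , scons (a , rcons av rnil , p) q , r , ≡-trans (m≤n⇒m⊔n≡n 1≤) e
    child-realised false true {v = v} av 1≤ refl snil r e =
      v , v , 0 , refl , snil , Reach-trans r (rcons av rnil) , ≡-trans (m≤n⇒m⊔n≡n 1≤) e
    child-realised false false av 1≤ refl snil r refl with 1≤
    ... | ()
    child-realised false b′ {v = v} {w′ = w′} {l} av 1≤ refl (scons (c , p , p′) q) r e =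
      v , w′ , l , refl , scons (c , Reach-trans p (rcons av rnil) , p′) q , r , ≡-trans (m≤n⇒m⊔n≡n 1≤) e

  realised : ∀ {k} (T : OTree (Fin m) k) → Sound T → ∀ i j → Realised T i j
  realised (single v) _ i j = v , v , 0 , refl , snil , refl , refl
  realised (addChild T s v) (a , S) = go
    where
    T′ : OTree (Fin m) _
    T′ = addChild T s v
    M : TreeMetric (δ T) (down T)
    M = δ-metric T
    new : ∀ j → Realised T′ zero (suc j)
    new j with j ≟F s
    ... | yes refl = v , v , 0 , refl , snil , rcons a rnil , cong (1 ⊔_) (TreeMetric.δ-diag M s)
    ... | no j≢s with realised T S s j
    ...   | w , w′ , l , p , q , r , e =
      child-realised (down T s j) (down T j s) a (TreeMetric.δ-pos M (λ e → j≢s (≡-sym e))) p q r e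
    go : ∀ i j → Realised T′ i j
    go zero    zero    = v , v , 0 , refl , snil , refl , refl
    go zero    (suc j) = new j
    go (suc i) zero    = Realised-sym T′ zero (suc i) (new i)
    go (suc i) (suc j) = realised T S i j
  realised (addParent T s v) (a , S) = go
    where
    T′ : OTree (Fin m) _
    T′ = addParent T s v
    new : ∀ j → Realised T′ zero (suc j)
    new j with realised T S s j
    ... | w , w′ , l , p , q , r , e with down T s j
    ...   | true  = w , w′ , l , rcons a p , q , r , e
    ...   | false = w , w′ , l , subst (Reach arc v) p (rcons a rnil) , q , r , cong suc e
    go : ∀ i j → Realised T′ i j
    go zero    zero    = v , v , 0 , refl , snil , refl , refl
    go zero    (suc j) = new j
    go (suc i) zero    = Realised-sym T′ zero (suc i) (new i)
    go (suc i) (suc j) = realised T S i j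

  module _ {k} (T : OTree (Fin m) k) (C : Complete T) (inj : LabelInjective T) (surj : ∀ v → Im T v) where

    open TreeMetric (δ-metric T)

    reach-δ : ∀ {u v} → Reach arc u v → ∀ i j → label T i ≡ u → label T j ≡ v →
      i ≡ j ⊎ (δ T i j ≡ 1 × down T i j ≡ true × down T j i ≡ false)
    reach-δ rnil i j p q = inj₁ (inj i j (≡-trans p (≡-sym q)))
    reach-δ (rcons {w = w} a r) i j refl q with surj w
    ... | l , refl with TArc-δ T i l (C i l a) | reach-δ r l j refl q
    ...   | h | inj₁ refl = inj₂ h
    ...   | δil , dil , dli | inj₂ (δlj , dlj , djl) =
      inj₂ (≡-trans (δ-sym i j) (suc-injective (≡-trans (down-up dlj dli i≢l) (cong₂ _+_ δlj (≡-trans (δ-sym l i) δil)))) ,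
            ≡-trans (proj₂ (down-sep dlj dli i≢l)) dil ,
            ≡-trans (proj₁ (down-sep dlj dli i≢l)) djl)
      where
      i≢l : i ≢ l
      i≢l refl = true≢false dil dli

    shared-δ : ∀ i j → SharedAnc (label T i) (label T j) → δ T i j ≤ 1
    shared-δ i j (a , p , q) with surj a
    ... | l , refl with reach-δ p l i refl refl | reach-δ q l j refl refl
    ...   | inj₁ refl | inj₁ refl = ≤-trans (≤-reflexive (δ-diag l)) z≤n
    ...   | inj₁ refl | inj₂ (e , _) = ≤-reflexive e
    ...   | inj₂ (e , _) | inj₁ refl = ≤-reflexive (≡-trans (δ-sym i l) e)
    ...   | inj₂ (e , d , _) | inj₂ (e′ , d′ , _) with ≤-trans (down-down d d′) (≤-reflexive (cong₂ _+_ e e′))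
    ...     | s≤s h = h

module _ {n} (N : Network n) where

  private
    _⊏_ : Fin (m N) → Fin (m N) → Set
    u ⊏ v = ∃[ w ] (arc N u w ≡ true × Reach (arc N) w v)

    ⊏-spo : IsStrictPartialOrder _≡_ _⊏_
    ⊏-spo = record
      { isEquivalence = isEquivalence
      ; irrefl = λ { {u} refl (w , a , r) → acyclic N u w a r }
      ; trans = λ (w , a , r) (w′ , a′ , r′) → w , a , Reach-trans r (rcons a′ r′)
      ; <-resp-≈ = (λ { refl h → h }) , (λ { refl h → h }) }

    descend : ∀ v → Acc (flip _⊏_) v → ∃[ x ] Reach (arc N) v (leaf N x)
    descend v (acc rs) with outdeg N v in e
    ... | zero with Equivalence.to (leaves N v) (sink-indeg N v e , e)
    ...   | x , refl = x , rnil
    descend v (acc rs) | suc _ with countF-witness (arc N v) (subst (1 ≤_) (≡-sym e) (s≤s z≤n))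
    ... | w , a with descend w (rs (w , a , rnil))
    ...   | x , r = x , rcons a r

  leaf-below : ∀ v → ∃[ x ] Reach (arc N) v (leaf N x)
  leaf-below v = descend v (spo-noetherian ⊏-spo v)

  leaf-sink : ∀ {x v} → Reach (arc N) (leaf N x) v → leaf N x ≡ v
  leaf-sink rnil = refl
  leaf-sink {x} (rcons {w = w} a r)
    with subst (1 ≤_) (proj₂ (Equivalence.from (leaves N (leaf N x)) (x , refl))) (countF-≥1 (arc N (leaf N x)) w a)
  ... | ()

  arboreal⇒ptolemaic : (G : Graph n) → Arboreal N → Represents N G → Ptolemaic G
  arboreal⇒ptolemaic G (con , ac) rep x y z u dxy dzu dxu dyz dxz dyu Hxy Hzu Hxu Hyz Hxz Hyu
    with Growth.spanning (arc N) (loopless N) (λ a b → acyclic N _ _ a (rcons b rnil)) ac con (leaf N x)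
  ... | k , (T , S , C , inj) , surj =
    subst₂ _≤_ (cong₂ _*_ (δ≡ Hxz) (δ≡ Hyu)) (cong₂ _+_ (cong₂ _*_ (δ≡ Hxy) (δ≡ Hzu)) (cong₂ _*_ (δ≡ Hxu) (δ≡ Hyz)))
      (proj₁ (proj₂ (ptolemy (ix x) (ix y) (ix z) (ix u))))
    where
    open TreeDistance (arc N) (loopless N) (λ a b → acyclic N _ _ a (rcons b rnil))
    open TreeMetric (δ-metric T)

    ix : Fin n → Fin k
    ix x = proj₁ (surj (leaf N x))

    ix-label : ∀ x → label T (ix x) ≡ leaf N x
    ix-label x = proj₂ (surj (leaf N x))

    below : Fin (m N) → Fin n
    below v = proj₁ (leaf-below v)

    below-leaf : ∀ x → below (leaf N x) ≡ x
    below-leaf x = ≡-sym (leaf-inj N x _ (leaf-sink (proj₂ (leaf-below (leaf N x)))))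

    project : ∀ {v w l} → SWalk v w l → ∃[ l′ ] (l′ ≤ l × Walk G (below v) (below w) l′)
    project snil = 0 , z≤n , wnil
    project (scons {u} {w} (a , p , q) s) with project s
    ... | l′ , le , wk with below u ≟F below w
    ...   | yes e = l′ , m≤n⇒m≤1+n le , subst (λ v → Walk G v _ l′) (≡-sym e) wk
    ...   | no ne = suc l′ , s≤s le ,
      wcons (Equivalence.from (rep _ _ ne)
        (a , Reach-trans p (proj₂ (leaf-below u)) , Reach-trans q (proj₂ (leaf-below w)))) wk

    start-leaf : ∀ b {v x w} → v ≡ leaf N x → Start b v w → w ≡ leaf N x
    start-leaf true  refl r = ≡-sym (leaf-sink r)
    start-leaf false refl r = ≡-sym r

    upper : ∀ x y → ∃[ l ] (l ≤ δ T (ix x) (ix y) × Walk G x y l)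
    upper x y with realised T S (ix x) (ix y)
    ... | w , w′ , l , p , q , r , e
      with start-leaf (down T (ix x) (ix y)) (ix-label x) p | start-leaf (down T (ix y) (ix x)) (ix-label y) r
    ...   | refl | refl with project q
    ...     | l′ , le , wk = l′ ,
      ≤-trans le (≤-trans (≤-trans (m≤m+n l _) (m≤n+m _ (bit (down T (ix x) (ix y))))) (≤-reflexive (≡-sym e))) ,
      subst₂ (λ v v′ → Walk G v v′ l′) (below-leaf x) (below-leaf y) wk

    lower : ∀ {x y l} → Walk G x y l → δ T (ix x) (ix y) ≤ l
    lower {x} wnil = ≤-reflexive (δ-diag (ix x))
    lower {x} {y} (wcons {z = z} a w) =
      ≤-trans (δ-tri (ix x) (ix z) (ix y))
        (+-mono-≤ (shared-δ T C inj surj (ix x) (ix z)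
                     (subst₂ SharedAnc (≡-sym (ix-label x)) (≡-sym (ix-label z)) (Equivalence.to (rep x z x≢z) a)))
                  (lower w))
      where
      x≢z : x ≢ z
      x≢z refl = true≢false a (irrefl G x)

    δ≡ : ∀ {x y l} → IsDist G x y l → δ T (ix x) (ix y) ≡ l
    δ≡ {x} {y} (w , min) with upper x y
    ... | l′ , le , w′ = ≤-antisym (lower w) (≤-trans (min l′ w′) le)

-- Subsets

⊆∧⊄⇒⊇ : ∀ {n} {A B : Subset n} → A ⊆ B → ¬ A ⊂ B → B ⊆ A
⊆∧⊄⇒⊇ {A = A} A⊆B ¬⊂ {x} x∈B with x ∈? A
... | yes p = p
... | no p  = ⊥-elim (¬⊂ (A⊆B , x , x∈B , p))

⊈⇒∃ : ∀ {n} {A B : Subset n} → ¬ A ⊆ B → ∃[ x ] (x ∈ A × x ∉ B)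
⊈⇒∃ {A = A} {B} ¬⊆ with any? (λ x → (x ∈? A) ×-dec ¬? (x ∈? B))
... | yes p = p
... | no ¬p = ⊥-elim (¬⊆ λ {x} x∈A → inB x x∈A)
  where
  inB : ∀ x → x ∈ A → x ∈ B
  inB x x∈A with x ∈? B
  ... | yes q = q
  ... | no q  = ⊥-elim (¬p (x , x∈A , q))

⁅x⁆⊆ : ∀ {n} {x : Fin n} {A} → x ∈ A → ⁅ x ⁆ ⊆ A
⁅x⁆⊆ {x = x} {A} x∈A y∈ = subst (_∈ A) (≡-sym (x∈⁅y⁆⇒x≡y x y∈)) x∈A

two-elements : ∀ {n} {A : Subset n} {x y} → x ∈ A → y ∈ A → x ≢ y → 2 ≤ ∣ A ∣
two-elements {A = A} {x} {y} x∈ y∈ x≢y =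
  subst (λ k → suc k ≤ ∣ A ∣) (∣⁅x⁆∣≡1 x)
    (p⊂q⇒∣p∣<∣q∣ (⁅x⁆⊆ x∈ , y , y∈ , λ p → x≢y (≡-sym (x∈⁅y⁆⇒x≡y x p))))

other-element : ∀ {n} {A : Subset n} → 2 ≤ ∣ A ∣ → ∀ x → ∃[ y ] (y ∈ A × y ≢ x)
other-element {A = A} le x with ⊈⇒∃ {A = A} {⁅ x ⁆} (λ s → <⇒≱ le (subst (∣ A ∣ ≤_) (∣⁅x⁆∣≡1 x) (p⊆q⇒∣p∣≤∣q∣ s)))
... | y , y∈ , y∉ = y , y∈ , λ e → y∉ (subst (_∈ ⁅ x ⁆) (≡-sym e) (x∈⁅x⁆ x))

module _ {n} {P : Subset n → Set} (P? : Decidable P) where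

  maximal-above : ∀ {A} → P A → ∃[ B ] (A ⊆ B × P B × (∀ C → P C → ¬ B ⊂ C))
  maximal-above {A} = go n (s≤s (m≤n+m n ∣ A ∣))
    where
    go : ∀ f {A} → n < suc (∣ A ∣ + f) → P A → ∃[ B ] (A ⊆ B × P B × (∀ C → P C → ¬ B ⊂ C))
    go f {A} lt pA with anySubset? (λ C → P? C ×-dec (A ⊂? C))
    ... | no ¬p = A , (λ x → x) , pA , λ C pC A⊂C → ¬p (C , pC , A⊂C)
    go zero {A} (s≤s lt) pA | yes (C , pC , A⊂C) =
      ⊥-elim (<⇒≱ (p⊂q⇒∣p∣<∣q∣ A⊂C) (≤-trans (∣p∣≤n C) (≤-trans lt (≤-reflexive (+-identityʳ _)))))
    go (suc f) {A} (s≤s lt) pA | yes (C , pC , A⊂C)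
      with go f (s≤s (≤-trans lt (≤-trans (≤-reflexive (+-suc ∣ A ∣ f)) (+-monoˡ-≤ f (p⊂q⇒∣p∣<∣q∣ A⊂C))))) pC
    ... | B , C⊆B , pB , max = B , (λ x → C⊆B (proj₁ A⊂C x)) , pB , max

  minimal-below : ∀ {A} → P A → ∃[ B ] (B ⊆ A × P B × (∀ C → P C → ¬ C ⊂ B))
  minimal-below {A} = go ∣ A ∣ ≤-refl
    where
    go : ∀ f {A} → ∣ A ∣ ≤ f → P A → ∃[ B ] (B ⊆ A × P B × (∀ C → P C → ¬ C ⊂ B))
    go f {A} le pA with anySubset? (λ C → P? C ×-dec (C ⊂? A))
    ... | no ¬p = A , (λ x → x) , pA , λ C pC C⊂A → ¬p (C , pC , C⊂A)
    go f {A} le pA | yes (C , pC , C⊂A) with ≤-trans (p⊂q⇒∣p∣<∣q∣ C⊂A) le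
    ... | s≤s le′ with go _ le′ pC
    ...   | B , B⊆C , pB , min = B , (λ x → proj₁ C⊂A (B⊆C x)) , pB , min

-- Intersection closures

module Closure {n} (K : Subset n → Set) where

  𝒞 : Subset n → Set
  𝒞 = IntersectionClosure K

  -- A decidable form of membership in 𝒞.
  Cl : Subset n → Set
  Cl A = Nonempty A × (∃[ Y ] (K Y × A ⊆ Y)) × (∀ x → x ∉ A → ∃[ Y ] (K Y × A ⊆ Y × x ∉ Y))

  private
    ⋂⊆ : ∀ (Y : Subset n) Ys {x Z} → x ∈ foldr _∩_ Y Ys → Z ∈ₗ (Y ∷ Ys) → x ∈ Z
    ⋂⊆ Y []       x∈ (here refl) = x∈
    ⋂⊆ Y (W ∷ Ys) x∈ (here refl) = ⋂⊆ Y Ys (proj₂ (x∈p∩q⁻ W _ x∈)) (here refl)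
    ⋂⊆ Y (W ∷ Ys) x∈ (there (here refl)) = proj₁ (x∈p∩q⁻ W _ x∈)
    ⋂⊆ Y (W ∷ Ys) x∈ (there (there i)) = ⋂⊆ Y Ys (proj₂ (x∈p∩q⁻ W _ x∈)) (there i)

    ⋂-greatest : ∀ (Y : Subset n) Ys {x} → x ∈ Y → All (x ∈_) Ys → x ∈ foldr _∩_ Y Ys
    ⋂-greatest Y []       p []       = p
    ⋂-greatest Y (W ∷ Ys) p (q ∷ qs) = x∈p∩q⁺ (q , ⋂-greatest Y Ys p qs)

    ∉⋂ : ∀ (Y : Subset n) Ys {x} → x ∉ foldr _∩_ Y Ys → ∃[ Z ] (Z ∈ₗ (Y ∷ Ys) × x ∉ Z)
    ∉⋂ Y []       x∉ = Y , here refl , x∉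
    ∉⋂ Y (W ∷ Ys) {x} x∉ with x ∈? W
    ... | no q  = W , there (here refl) , q
    ... | yes q with ∉⋂ Y Ys (λ p → x∉ (x∈p∩q⁺ (q , p)))
    ...   | Z , here e  , r = Z , here e , r
    ...   | Z , there i , r = Z , there (there i) , r

  𝒞⇒Cl : ∀ {A} → 𝒞 A → Cl A
  𝒞⇒Cl (Y , Ys , ks , refl , ne) =
    ne , (Y , All.head ks , λ x∈ → ⋂⊆ Y Ys x∈ (here refl)) ,
    λ x x∉ → let Z , Z∈ , x∉Z = ∉⋂ Y Ys x∉ in Z , All.lookup ks Z∈ , (λ y∈ → ⋂⊆ Y Ys y∈ Z∈) , x∉Z

  Cl⇒𝒞 : ∀ {A} → Cl A → 𝒞 A
  Cl⇒𝒞 {A} (ne , (Y , kY , A⊆Y) , sep) =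
    Y , map W (allFin n) , kY ∷ All.map⁺ (All.universal (λ x → proj₁ (W-spec x)) _) ,
    ⊆-antisym (λ x∈ → ⋂-greatest Y (map W (allFin n)) (A⊆Y x∈) (All.map⁺ (All.universal (λ y → proj₁ (proj₂ (W-spec y)) x∈) _)))
              back ,
    ne
    where
    pick : ∀ x → ∃[ Z ] (K Z × A ⊆ Z × (x ∈ Z → x ∈ A))
    pick x with x ∈? A
    ... | yes p = Y , kY , A⊆Y , λ _ → p
    ... | no p  = let Z , kZ , A⊆Z , x∉Z = sep x p in Z , kZ , A⊆Z , λ q → ⊥-elim (x∉Z q)
    W : Fin n → Subset n
    W x = proj₁ (pick x)
    W-spec : ∀ x → K (W x) × A ⊆ W x × (x ∈ W x → x ∈ A)
    W-spec x = proj₂ (pick x)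
    back : foldr _∩_ Y (map W (allFin n)) ⊆ A
    back {x} x∈ = proj₂ (proj₂ (W-spec x)) (⋂⊆ Y (map W (allFin n)) x∈ (there (∈-map⁺ W (∈-allFin x))))

  nonempty : ∀ {A} → 𝒞 A → Nonempty A
  nonempty c = proj₁ (𝒞⇒Cl c)

  contained : ∀ {A} → 𝒞 A → ∃[ Y ] (K Y × A ⊆ Y)
  contained c = proj₁ (proj₂ (𝒞⇒Cl c))

  avoid : ∀ {A} → 𝒞 A → ∀ {x} → x ∉ A → ∃[ Y ] (K Y × A ⊆ Y × x ∉ Y)
  avoid c {x} = proj₂ (proj₂ (𝒞⇒Cl c)) x

  K⇒𝒞 : ∀ {A} → K A → Nonempty A → 𝒞 A
  K⇒𝒞 {A} k ne = A , [] , k ∷ [] , refl , ne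

  𝒞-∩ : ∀ {A B} → 𝒞 A → 𝒞 B → Nonempty (A ∩ B) → 𝒞 (A ∩ B)
  𝒞-∩ {A} {B} a b ne with contained a
  ... | Y , kY , A⊆Y = Cl⇒𝒞 (ne , (Y , kY , λ x∈ → A⊆Y (p∩q⊆p A B x∈)) , sep)
    where
    sep : ∀ x → x ∉ A ∩ B → ∃[ Y ] (K Y × A ∩ B ⊆ Y × x ∉ Y)
    sep x x∉ with x ∈? A
    ... | no p  = let Z , kZ , A⊆Z , q = avoid a p in Z , kZ , (λ y∈ → A⊆Z (p∩q⊆p A B y∈)) , q
    ... | yes p = let Z , kZ , B⊆Z , q = avoid b (λ r → x∉ (x∈p∩q⁺ (p , r))) in
                  Z , kZ , (λ y∈ → B⊆Z (p∩q⊆q A B y∈)) , q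

  cover-meet : ∀ {A B D a} → HArc 𝒞 A B → 𝒞 D → B ⊆ D → a ∈ A → a ∉ D → ∀ {x} → x ∈ A → x ∈ D → x ∈ B
  cover-meet {A} {B} {D} {a} (cA , cB , (B⊆A , _) , cov) cD B⊆D a∈A a∉D {x} x∈A x∈D with x ∈? B
  ... | yes p = p
  ... | no p  = ⊥-elim (cov (A ∩ D , 𝒞-∩ cA cD (x , x∈p∩q⁺ (x∈A , x∈D)) ,
                  ((λ y∈ → x∈p∩q⁺ (B⊆A y∈ , B⊆D y∈)) , x , x∈p∩q⁺ (x∈A , x∈D) , p) ,
                  (p∩q⊆p A D , a , a∈A , λ q → a∉D (p∩q⊆q A D q))))

  module Decide (K? : Decidable K) where

    abstract
      𝒞? : Decidable 𝒞
      𝒞? A = map′ Cl⇒𝒞 𝒞⇒Cl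
        (nonempty? A ×-dec (anySubset? (λ Y → K? Y ×-dec (A ⊆? Y)) ×-dec
          all? (λ x → ¬? (x ∈? A) →-dec anySubset? (λ Y → K? Y ×-dec ((A ⊆? Y) ×-dec ¬? (x ∈? Y))))))

    cover-below : ∀ {C D} → 𝒞 C → 𝒞 D → C ⊂ D → ∃[ E ] (HArc 𝒞 D E × C ⊆ E)
    cover-below {C} {D} cC cD C⊂D
      with maximal-above (λ E → 𝒞? E ×-dec ((C ⊆? E) ×-dec (E ⊂? D))) (cC , (λ x → x) , C⊂D)
    ... | E , C⊆E , (cE , _ , E⊂D) , max =
      E , (cD , cE , E⊂D , λ (F , cF , E⊂F , F⊂D) → max F (cF , (λ x → proj₁ E⊂F (C⊆E x)) , F⊂D) E⊂F) , C⊆E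

    cover-above : ∀ {C D} → 𝒞 C → 𝒞 D → C ⊂ D → ∃[ E ] (HArc 𝒞 E C × E ⊆ D)
    cover-above {C} {D} cC cD C⊂D
      with minimal-below (λ E → 𝒞? E ×-dec (C ⊂? E)) (cD , C⊂D)
    ... | E , E⊆D , (cE , C⊂E) , min =
      E , (cE , cC , C⊂E , λ (F , cF , C⊂F , F⊂E) → min F (cF , C⊂F) F⊂E) , E⊆D

_≟S_ : ∀ {n} → DecidableEquality (Subset n)
_≟S_ = Vec.≡-dec Bool._≟_

-- Cliques

module Adjacency {n} (G : Graph n) where

  infix 4 _~_

  _~_ : Fin n → Fin n → Set
  x ~ y = adj G x y ≡ true

  _~?_ : ∀ x y → Dec (x ~ y)
  x ~? y = adj G x y Bool.≟ true

  ~-sym : ∀ {x y} → x ~ y → y ~ x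
  ~-sym {x} {y} e = ≡-trans (sym G y x) e

  ~⇒≢ : ∀ {x y} → x ~ y → x ≢ y
  ~⇒≢ {x} e refl = true≢false e (irrefl G x)

  clique-adj : ∀ {Y x y} → Clique G Y → x ∈ Y → y ∈ Y → x ≡ y ⊎ x ~ y
  clique-adj {Y} {x} {y} (_ , c) x∈ y∈ with x ≟F y
  ... | yes e = inj₁ e
  ... | no ne = inj₂ (c x y x∈ y∈ ne)

  abstract
    clique? : Decidable (Clique G)
    clique? Y = (2 ≤? ∣ Y ∣) ×-dec
      all? (λ x → all? (λ y → (x ∈? Y) →-dec ((y ∈? Y) →-dec (¬? (x ≟F y) →-dec (x ~? y)))))

    maxClique? : Decidable (MaxClique G)
    maxClique? Y = map′
      (λ (c , m) → c , λ Z cZ Y⊆Z → ⊆-antisym (⊆∧⊄⇒⊇ Y⊆Z (λ Y⊂Z → m (Z , cZ , Y⊂Z))) Y⊆Z)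
      (λ (c , m) → c , λ (Z , cZ , Y⊆Z , x , x∈Z , x∉Y) → x∉Y (subst (x ∈_) (m Z cZ Y⊆Z) x∈Z))
      (clique? Y ×-dec ¬? (anySubset? (λ Z → clique? Z ×-dec (Y ⊂? Z))))

  clique⇒max : ∀ {Y} → Clique G Y → ∃[ Q ] (MaxClique G Q × Y ⊆ Q)
  clique⇒max c with maximal-above clique? c
  ... | Q , Y⊆Q , cQ , max =
    Q , (cQ , λ Z cZ Q⊆Z → ⊆-antisym (⊆∧⊄⇒⊇ Q⊆Z (max Z cZ)) Q⊆Z) , Y⊆Q

  edge⇒max : ∀ {x y} → x ~ y → ∃[ Q ] (MaxClique G Q × x ∈ Q × y ∈ Q)
  edge⇒max {x} {y} e with clique⇒max {⁅ x ⁆ ∪ ⁅ y ⁆} (two-elements x∈ y∈ (~⇒≢ e) , adjacent)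
    where
    x∈ : x ∈ ⁅ x ⁆ ∪ ⁅ y ⁆
    x∈ = x∈p∪q⁺ (inj₁ (x∈⁅x⁆ x))
    y∈ : y ∈ ⁅ x ⁆ ∪ ⁅ y ⁆
    y∈ = x∈p∪q⁺ (inj₂ (x∈⁅x⁆ y))
    adjacent : ∀ u v → u ∈ ⁅ x ⁆ ∪ ⁅ y ⁆ → v ∈ ⁅ x ⁆ ∪ ⁅ y ⁆ → u ≢ v → u ~ v
    adjacent u v u∈ v∈ u≢v with x∈p∪q⁻ ⁅ x ⁆ ⁅ y ⁆ u∈ | x∈p∪q⁻ ⁅ x ⁆ ⁅ y ⁆ v∈
    ... | inj₁ p | inj₁ q = ⊥-elim (u≢v (≡-trans (x∈⁅y⁆⇒x≡y x p) (≡-sym (x∈⁅y⁆⇒x≡y x q))))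
    ... | inj₂ p | inj₂ q = ⊥-elim (u≢v (≡-trans (x∈⁅y⁆⇒x≡y y p) (≡-sym (x∈⁅y⁆⇒x≡y y q))))
    ... | inj₁ p | inj₂ q rewrite x∈⁅y⁆⇒x≡y x p | x∈⁅y⁆⇒x≡y y q = e
    ... | inj₂ p | inj₁ q rewrite x∈⁅y⁆⇒x≡y y p | x∈⁅y⁆⇒x≡y x q = ~-sym e
  ... | Q , mQ , s = Q , mQ , s (x∈p∪q⁺ (inj₁ (x∈⁅x⁆ x))) , s (x∈p∪q⁺ (inj₂ (x∈⁅x⁆ y)))

  max-nonempty : ∀ {Q} → MaxClique G Q → Nonempty Q
  max-nonempty {Q} ((le , _) , _) with nonempty? Q
  ... | yes p = p
  ... | no ¬p = ⊥-elim (empty (Empty-unique ¬p) le)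
    where
    empty : Q ≡ ∅ → ¬ 2 ≤ ∣ Q ∣
    empty refl h with subst (2 ≤_) (∣⊥∣≡0 n) h
    ... | ()

  nonneighbour : ∀ {Q m} → MaxClique G Q → m ∉ Q → ∃[ q ] (q ∈ Q × ¬ m ~ q)
  nonneighbour {Q} {m} ((le , c) , max) m∉Q
    with any? (λ q → (q ∈? Q) ×-dec ¬? (m ~? q))
  ... | yes p = p
  ... | no ¬p = ⊥-elim (m∉Q (subst (m ∈_) (max (Q ∪ ⁅ m ⁆) clique (p⊆p∪q ⁅ m ⁆)) (x∈p∪q⁺ (inj₂ (x∈⁅x⁆ m)))))
    where
    m~ : ∀ q → q ∈ Q → m ~ q
    m~ q q∈ with m ~? q
    ... | yes e = e
    ... | no ¬e = ⊥-elim (¬p (q , q∈ , ¬e))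
    adjacent : ∀ u v → u ∈ Q ∪ ⁅ m ⁆ → v ∈ Q ∪ ⁅ m ⁆ → u ≢ v → u ~ v
    adjacent u v u∈ v∈ u≢v with x∈p∪q⁻ Q ⁅ m ⁆ u∈ | x∈p∪q⁻ Q ⁅ m ⁆ v∈
    ... | inj₁ p | inj₁ q = c u v p q u≢v
    ... | inj₂ p | inj₂ q = ⊥-elim (u≢v (≡-trans (x∈⁅y⁆⇒x≡y m p) (≡-sym (x∈⁅y⁆⇒x≡y m q))))
    ... | inj₁ p | inj₂ q rewrite x∈⁅y⁆⇒x≡y m q = ~-sym (m~ u p)
    ... | inj₂ p | inj₁ q rewrite x∈⁅y⁆⇒x≡y m p = m~ v q
    clique : Clique G (Q ∪ ⁅ m ⁆)
    clique = ≤-trans le (∣p∣≤∣p∪q∣ Q ⁅ m ⁆) , adjacent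

  walk? : ∀ k x y → Dec (Walk G x y k)
  walk? zero x y = map′ (λ { refl → wnil }) (λ { wnil → refl }) (x ≟F y)
  walk? (suc k) x y = map′ (λ (z , e , w) → wcons e w) (λ { (wcons e w) → _ , e , w })
    (any? (λ z → (x ~? z) ×-dec walk? k z y))

  private
    least : ∀ {x y} f k → Walk G x y (k + f) → (∀ j → Walk G x y j → k ≤ j) → ∃[ d ] IsDist G x y d
    least {x} {y} f k w min with walk? k x y
    ... | yes w′ = k , w′ , min
    least zero k w min | no ¬w = ⊥-elim (¬w (subst (Walk G _ _) (+-identityʳ k) w))
    least {x} {y} (suc f) k w min | no ¬w = least f (suc k) (subst (Walk G _ _) (+-suc k f) w) above
      where
      above : ∀ j → Walk G x y j → suc k ≤ j
      above j w′ with suc k ≤? j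
      ... | yes p = p
      ... | no p  = ⊥-elim (¬w (subst (Walk G x y) (≤-antisym (≤-pred (≰⇒> p)) (min j w′)) w′))

  dist : Connected G → ∀ x y → ∃[ d ] IsDist G x y d
  dist con x y with con x y
  ... | k , w = least k 0 w (λ _ _ → z≤n)

  Far : Fin n → Fin n → Set
  Far x w = x ≢ w × ¬ x ~ w

  data IPath : Fin n → Fin n → List (Fin n) → Set where
    inil  : ∀ {x} → IPath x x []
    icons : ∀ {x z y ws} → x ~ z → All (Far x) ws → IPath z y ws → IPath x y (z ∷ ws)

  IPath⇒Walk : ∀ {x y ws} → IPath x y ws → Walk G x y (length ws)
  IPath⇒Walk inil          = wnil
  IPath⇒Walk (icons e _ p) = wcons e (IPath⇒Walk p)

  IPath-init : ∀ {z y w ws} → IPath z y (w ∷ ws) →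
    ∃[ y′ ] ∃[ vs ] (IPath z y′ vs × y′ ~ y × length vs ≡ length ws × (∀ {Q : Fin n → Set} → All Q (w ∷ ws) → All Q vs))
  IPath-init {z} (icons e f inil) = z , [] , inil , e , refl , λ _ → []
  IPath-init (icons {z = w} e f p@(icons _ _ _)) with IPath-init p
  ... | y′ , vs , p′ , e′ , l , sub =
    y′ , w ∷ vs , icons e (sub f) p′ , e′ , cong suc l , λ { (q ∷ qs) → q ∷ sub qs }

  private
    prepend : ∀ {S : Fin n → Set} x {z y ws} → IPath z y ws → S z → All S ws →
      All (Far x) (z ∷ ws) ⊎ (∃[ ws′ ] (IPath x y ws′ × All S ws′))
    prepend x {z} inil sz [] with x ≟F z | x ~? z
    ... | yes refl | _     = inj₂ ([] , inil , [])
    ... | no _     | yes e = inj₂ (z ∷ [] , icons e [] inil , sz ∷ [])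
    ... | no ne    | no ¬e = inj₁ ((ne , ¬e) ∷ [])
    prepend x {z} {ws = w ∷ ws} P@(icons e f p) sz (sw ∷ ss) with prepend x p sw ss
    ... | inj₂ r  = inj₂ r
    ... | inj₁ far with x ≟F z | x ~? z
    ...   | yes refl | _      = inj₂ (w ∷ ws , P , sw ∷ ss)
    ...   | no _     | yes e′ = inj₂ (z ∷ w ∷ ws , icons e′ far P , sz ∷ sw ∷ ss)
    ...   | no ne    | no ¬e  = inj₁ ((ne , ¬e) ∷ far)

  induced-path : ∀ {S : Fin n → Set} {x y} → UWalk (λ u v → u ~ v × S v) x y → ∃[ ws ] (IPath x y ws × All S ws)
  induced-path unil = [] , inil , []
  induced-path {x = x} (ucons (e , s) w) with induced-path w
  ... | ws , p , ss with prepend x p s ss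
  ...   | inj₂ r = r
  ...   | inj₁ ((_ , ¬e) ∷ _) = ⊥-elim (¬e e)

-- Ptolemaic graphs

module PtolemaicGraph {n} (G : Graph n) (con : Connected G) (pt : Ptolemaic G) where

  open Adjacency G

  dist-1 : ∀ {x y} → x ~ y → IsDist G x y 1
  dist-1 e = wcons e wnil , λ { zero wnil → ⊥-elim (~⇒≢ e refl) ; (suc k) _ → s≤s z≤n }

  dist-2 : ∀ {x z y} → x ~ z → z ~ y → x ≢ y → ¬ x ~ y → IsDist G x y 2
  dist-2 e e′ ne ¬e = wcons e (wcons e′ wnil) ,
    λ { zero wnil → ⊥-elim (ne refl) ; (suc zero) (wcons f wnil) → ⊥-elim (¬e f) ; (suc (suc k)) _ → s≤s (s≤s z≤n) }

  -- Rules out induced 4-cycles as well as gems.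
  no-gem : ∀ {p q r s k} → p ~ q → q ~ r → r ~ s → p ≢ r → ¬ p ~ r → q ≢ s → ¬ q ~ s → Walk G p s k → k ≤ 2 → ⊥
  no-gem {p} {q} {r} {s} {k} pq qr rs p≢r p≁r q≢s q≁s w k≤2 with dist con p s
  ... | d , D@(_ , min) = 1+n≰n (≤-trans (pt p q r s 1 1 d 1 2 2 (dist-1 pq) (dist-1 rs) D (dist-1 qr) (dist-2 pq qr p≢r p≁r) (dist-2 qr rs q≢s q≁s))
      (s≤s (≤-trans (≤-reflexive (*-identityʳ d)) (≤-trans (min k w) k≤2))))

  private
    geodesic-step : ∀ j {x z y′ y} → IsDist G x z 1 → IsDist G y′ y 1 → IsDist G z y′ (suc j) →
      IsDist G x y′ (suc (suc j)) → IsDist G z y (suc (suc j)) → Walk G x y (3 + j) → IsDist G x y (3 + j)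
    geodesic-step j {x} {z} {y′} {y} dxz dy′y dzy′ dxy′ dzy w with dist con x y
    ... | D , dxy@(_ , min) = subst (IsDist G x y) (≤-antisym (min (3 + j) w) D≥) dxy
      where
      ineq : (2 + j) * (2 + j) ≤ 1 + D * (1 + j)
      ineq = pt x z y′ y 1 1 D (1 + j) (2 + j) (2 + j) dxz dy′y dxy dzy′ dxy′ dzy
      D≥ : 3 + j ≤ D
      D≥ with 3 + j ≤? D
      ... | yes q = q
      ... | no q  = ⊥-elim (absurd (≤-trans ineq (+-monoʳ-≤ 1 (*-monoˡ-≤ (1 + j) (≤-pred (≰⇒> q))))))
        where
        absurd : ¬ (2 + j) * (2 + j) ≤ 1 + (2 + j) * (1 + j)
        absurd h with +-cancelʳ-≤ ((2 + j) * (1 + j)) (2 + j) 1 (subst (_≤ 1 + (2 + j) * (1 + j)) (*-suc (2 + j) (1 + j)) h)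
        ... | s≤s ()

  geodesic : ∀ k {x y ws} → IPath x y ws → length ws ≡ k → IsDist G x y k
  geodesic zero inil _ = wnil , λ _ _ → z≤n
  geodesic (suc zero) (icons e _ inil) _ = dist-1 e
  geodesic (suc (suc zero)) (icons e ((ne , ¬e) ∷ []) (icons e′ _ inil)) _ = dist-2 e e′ ne ¬e
  geodesic (suc (suc (suc j))) {x} {y} P@(icons {ws = w ∷ ws} e f p) l =
    let y′ , vs , p′ , y′y , l′ , sub = IPath-init p
        len = ≡-trans l′ (suc-injective (suc-injective l))
    in geodesic-step j (dist-1 e) (dist-1 y′y) (geodesic (suc j) p′ len)
         (geodesic (suc (suc j)) (icons e (sub f) p′) (cong suc len)) (geodesic (suc (suc j)) p (suc-injective l))
         (subst (Walk G x y) l (IPath⇒Walk P))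

  long-path : ∀ {x y k a b c ws} → IPath x y (a ∷ b ∷ c ∷ ws) → Walk G x y k → k ≤ 2 → ⊥
  long-path {k = k} p w k≤2 with ≤-trans (proj₂ (geodesic _ p refl) k w) k≤2
  ... | s≤s (s≤s ())

  open Closure (MaxClique G)

  via : ∀ {P Q x y b} → Clique G P → Clique G Q → x ∈ P → b ∈ P → b ∈ Q → y ∈ Q → ∃[ k ] (Walk G x y k × k ≤ 2)
  via cP cQ x∈ b∈ b∈′ y∈ with clique-adj cP x∈ b∈ | clique-adj cQ b∈′ y∈
  ... | inj₁ refl | inj₁ refl = 0 , wnil , z≤n
  ... | inj₁ refl | inj₂ e    = 1 , wcons e wnil , s≤s z≤n
  ... | inj₂ e    | inj₁ refl = 1 , wcons e wnil , s≤s z≤n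
  ... | inj₂ e    | inj₂ e′   = 2 , wcons e (wcons e′ wnil) , s≤s (s≤s z≤n)

  no-gem′ : ∀ {P Q p q r s b} → p ~ q → q ~ r → r ~ s → p ≢ r → ¬ p ~ r → q ≢ s → ¬ q ~ s →
    Clique G P → Clique G Q → p ∈ P → b ∈ P → b ∈ Q → s ∈ Q → ⊥
  no-gem′ pq qr rs p≢r p≁r q≢s q≁s cP cQ p∈ b∈ b∈′ s∈ =
    let k , w , le = via cP cQ p∈ b∈ b∈′ s∈ in no-gem pq qr rs p≢r p≁r q≢s q≁s w le

  Off : Subset n → Fin n → Fin n → Set
  Off B u v = u ~ v × u ∉ B × v ∉ B

  Off-sym : ∀ {B u v} → Off B u v → Off B v u
  Off-sym (e , p , q) = ~-sym e , q , p

  module Cover {A B} (arcAB : HArc 𝒞 A B) where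

    cA : 𝒞 A
    cA = proj₁ arcAB
    cB : 𝒞 B
    cB = proj₁ (proj₂ arcAB)
    B⊆A : B ⊆ A
    B⊆A = proj₁ (proj₁ (proj₂ (proj₂ arcAB)))

    common-neighbour : ∀ {Q a q m} → MaxClique G Q → B ⊆ Q → a ∈ A → a ∉ Q → q ∈ Q → ¬ a ~ q →
      a ~ m → m ~ q → m ∈ B
    common-neighbour {Q} {a} {q} {m} mQ B⊆Q a∈A a∉Q q∈Q a≁q am mq with m ∈? Q
    ... | no m∉Q with nonneighbour mQ m∉Q | nonempty cB | contained cA
    ...   | q′ , q′∈ , m≁q′ | b , b∈ | P , (cP , _) , A⊆P =
      ⊥-elim (no-gem′ am mq (proj₂ (proj₁ mQ) q q′ q∈Q q′∈ (λ { refl → m≁q′ mq }))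
        (λ { refl → a∉Q q∈Q }) a≁q (λ { refl → m∉Q q′∈ }) m≁q′
        cP (proj₁ mQ) (A⊆P a∈A) (A⊆P (B⊆A b∈)) (B⊆Q b∈) q′∈)
    common-neighbour {Q} {a} {q} {m} mQ B⊆Q a∈A a∉Q q∈Q a≁q am mq | yes m∈Q with m ∈? A
    ... | yes m∈A = cover-meet arcAB (K⇒𝒞 mQ (max-nonempty mQ)) B⊆Q a∈A a∉Q m∈A m∈Q
    ... | no m∉A with avoid cA m∉A | nonempty cB
    ...   | P , mP , A⊆P , m∉P | b , b∈ with nonneighbour mP m∉P
    ...     | p , p∈ , m≁p =
      ⊥-elim (no-gem′ (proj₂ (proj₁ mP) p a p∈ (A⊆P a∈A) (λ { refl → m≁p (~-sym am) })) am mq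
        (λ { refl → m∉P p∈ }) (λ e → m≁p (~-sym e)) (λ { refl → a∉Q q∈Q }) a≁q
        (proj₁ mP) (proj₁ mQ) p∈ (A⊆P (B⊆A b∈)) (B⊆Q b∈) q∈Q)

    separated : ∀ {Q a q} → MaxClique G Q → B ⊆ Q → a ∈ A → a ∉ Q → q ∈ Q → ¬ a ~ q → ¬ UWalk (Off B) a q
    separated {Q} {a} {q} mQ B⊆Q a∈A a∉Q q∈Q a≁q w
      with induced-path {S = _∉ B} (UWalk-map (λ (e , _ , s) → e , s) w)
    ... | [] , inil , _ = a∉Q q∈Q
    ... | _ ∷ [] , icons e _ inil , _ = a≁q e
    ... | _ ∷ _ ∷ [] , icons e _ (icons e′ _ inil) , m∉ ∷ _ =
      m∉ (common-neighbour mQ B⊆Q a∈A a∉Q q∈Q a≁q e e′)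
    ... | _ ∷ _ ∷ _ ∷ _ , p , _ =
      let b , b∈ = nonempty cB
          P , (cP , _) , A⊆P = contained cA
          k , wk , le = via cP (proj₁ mQ) (A⊆P a∈A) (A⊆P (B⊆A b∈)) (B⊆Q b∈) q∈Q
      in long-path p wk le

module HAcyclic {n} (G : Graph n) (con : Connected G) (pt : Ptolemaic G) where

  open Adjacency G
  open PtolemaicGraph G con pt
  open Closure (MaxClique G)

  Off-end : ∀ {B u v} → u ∉ B → UWalk (Off B) u v → v ∉ B
  Off-end u∉ unil                    = u∉
  Off-end u∉ (ucons (_ , _ , w∉) p) = Off-end w∉ p

  module _ {A B} (arcAB : HArc 𝒞 A B) where

    open Cover arcAB

    private
      a : Fin n
      a = proj₁ (proj₂ (proj₁ (proj₂ (proj₂ arcAB))))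
      a∈A : a ∈ A
      a∈A = proj₁ (proj₂ (proj₂ (proj₁ (proj₂ (proj₂ arcAB)))))
      a∉B : a ∉ B
      a∉B = proj₂ (proj₂ (proj₂ (proj₁ (proj₂ (proj₂ arcAB)))))

    Meets : Subset n → Set
    Meets C = ∃[ c ] (c ∈ C × UWalk (Off B) a c)

    private
      extend-in : ∀ {Y c r} → Clique G Y → UWalk (Off B) a c → c ∈ Y → r ∈ Y → r ∉ B → UWalk (Off B) a r
      extend-in cY w c∈ r∈ r∉ with clique-adj cY c∈ r∈
      ... | inj₁ refl = w
      ... | inj₂ e    = w ++ᵤ ucons (e , Off-end a∉B w , r∉) unil

      outside-B : ∀ {Y b r} → Clique G Y → B ⊆ Y → b ∈ Y → r ≢ b → ¬ b ~ r → r ∉ B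
      outside-B cY B⊆Y b∈ r≢b b≁r r∈ with clique-adj cY b∈ (B⊆Y r∈)
      ... | inj₁ refl = r≢b refl
      ... | inj₂ e    = b≁r e

      lower-is-B : ∀ {C D c} → HArc 𝒞 C D → D ⊆ B → c ∈ C → UWalk (Off B) a c → B ⊆ D
      lower-is-B {C} {D} {c} arcCD@(cC , cD , _) D⊆B c∈C w {b} b∈B with b ∈? D
      ... | yes p  = p
      ... | no b∉D with avoid cC (λ b∈C → b∉D (cover-meet arcCD cB D⊆B c∈C (Off-end a∉B w) b∈C b∈B))
      ...   | R , mR , C⊆R , b∉R with nonneighbour mR b∉R | avoid cB a∉B
      ...     | r , r∈R , b≁r | Q , mQ , B⊆Q , a∉Q with nonneighbour mQ a∉Q | nonempty cD | contained cA
      ...       | q , q∈Q , a≁q | d , d∈D | P , (cP , _) , A⊆P = ⊥-elim (contra (induced-path walk))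
        where
        r∉B : r ∉ B
        r∉B = outside-B cP (λ x → A⊆P (B⊆A x)) (A⊆P (B⊆A b∈B)) (λ { refl → b∉R r∈R }) b≁r
        q∉B : q ∉ B
        q∉B = outside-B cP (λ x → A⊆P (B⊆A x)) (A⊆P a∈A) (λ { refl → a∉Q q∈Q }) a≁q
        ¬q : ¬ UWalk (Off B) a q
        ¬q = separated mQ B⊆Q a∈A a∉Q q∈Q a≁q
        lift : ∀ {x y} → UWalk (Off B) a x → UWalk (Off B) x y → UWalk (λ u v → u ~ v × UWalk (Off B) a v) x y
        lift p unil = unil
        lift p (ucons (e , s) w) = let p′ = p ++ᵤ ucons (e , s) unil in ucons (e , p′) (lift p′ w)
        ba : b ~ a
        ba = proj₂ cP b a (A⊆P (B⊆A b∈B)) (A⊆P a∈A) (λ { refl → a∉B b∈B })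
        qb : q ~ b
        qb = proj₂ (proj₁ mQ) q b q∈Q (B⊆Q b∈B) (λ { refl → q∉B b∈B })
        far : ∀ {x} → UWalk (Off B) a x → Far q x
        far {x} p = (λ { refl → ¬q p }) , λ e → ¬q (p ++ᵤ ucons (~-sym e , Off-end a∉B p , q∉B) unil)
        walk : UWalk (λ u v → u ~ v × UWalk (Off B) a v) b r
        walk = ucons (ba , unil) (lift unil (extend-in (proj₁ mR) w (C⊆R c∈C) r∈R r∉B))
        contra : ¬ (∃[ ws ] (IPath b r ws × All (UWalk (Off B) a) ws))
        contra ([] , inil , _) = b∉R r∈R
        contra (_ ∷ [] , icons e _ inil , _) = b≁r e
        contra (_ ∷ _ ∷ _ , p , ss) =
          let k , wk , le = via (proj₁ mQ) (proj₁ mR) q∈Q (B⊆Q (D⊆B d∈D)) (C⊆R (proj₁ (proj₁ (proj₂ (proj₂ arcCD))) d∈D)) r∈R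
          in long-path (icons qb (All.map far ss) p) wk le

      upper-is-A : ∀ {C c} → HArc 𝒞 C B → c ∈ C → UWalk (Off B) a c → C ≡ A
      upper-is-A {C} {c} arcCB@(cC , _ , (B⊆C , _) , _) c∈C w with C ⊆? A
      ... | yes C⊆A =
        ⊆-antisym C⊆A (⊆∧⊄⇒⊇ C⊆A (λ C⊂A → proj₂ (proj₂ (proj₂ arcAB)) (C , cC , (B⊆C , c , c∈C , Off-end a∉B w) , C⊂A)))
      ... | no C⊈A with ⊈⇒∃ {A = C} {A} C⊈A
      ...   | y , y∈C , y∉A with avoid cA y∉A
      ...     | P , mP , A⊆P , y∉P with nonneighbour mP y∉P | contained cC
      ...       | p , p∈P , y≁p | R , (cR , _) , C⊆R =
        ⊥-elim (Cover.separated arcCB mP (λ x → A⊆P (B⊆A x)) y∈C y∉P p∈P y≁p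
          (UWalk-sym (Off-sym {B}) (extend-in cR w (C⊆R c∈C) (C⊆R y∈C) (λ y∈B → y∉P (A⊆P (B⊆A y∈B))))
           ++ᵤ extend-in (proj₁ mP) unil (A⊆P a∈A) p∈P
                 (outside-B cR (λ x → C⊆R (B⊆C x)) (C⊆R y∈C) (λ { refl → y∉P p∈P }) y≁p)))

    step-down : ∀ {C D} → HArc 𝒞 C D → Meets C → Meets D ⊎ (C ≡ A × D ≡ B)
    step-down {C} {D} arcCD@(cC , cD , (D⊆C , _) , _) (c , c∈C , w) with D ⊆? B
    ... | no D⊈B with ⊈⇒∃ {A = D} {B} D⊈B | contained cC
    ...   | d , d∈D , d∉B | R , (cR , _) , C⊆R = inj₁ (d , d∈D , extend-in cR w (C⊆R c∈C) (C⊆R (D⊆C d∈D)) d∉B)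
    step-down {C} {D} arcCD (c , c∈C , w) | yes D⊆B
      with ⊆-antisym D⊆B (lower-is-B arcCD D⊆B c∈C w)
    ... | refl = inj₂ (upper-is-A arcCD c∈C w , refl)

    meets-walk : ∀ {C D} → UWalk (Cut (Und (HArc 𝒞)) A B) C D → Meets C → Meets D
    meets-walk unil m = m
    meets-walk (ucons (inj₁ arc , ¬AB , _) w) m with step-down arc m
    ... | inj₁ m′       = meets-walk w m′
    ... | inj₂ eqs      = ⊥-elim (¬AB eqs)
    meets-walk (ucons (inj₂ (_ , _ , (C⊆D , _) , _) , _) w) (c , c∈C , p) = meets-walk w (c , C⊆D c∈C , p)

    cover-bridge : ¬ UWalk (Cut (Und (HArc 𝒞)) A B) A B
    cover-bridge w with meets-walk w (a , a∈A , unil)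
    ... | b , b∈B , p = Off-end a∉B p b∈B

  H-acyclic : UAcyclic 𝒞 (Und (HArc 𝒞))
  H-acyclic cs cyc with cycle⇒detour cs cyc
  ... | A , B , inj₁ arc , w = cover-bridge arc (UWalk-sym (Cut-sym (Und-sym {A = HArc 𝒞})) w)
  ... | A , B , inj₂ arc , w = cover-bridge arc (UWalk-map (λ (e , p , q) → e , q , p) w)

  Shared : Subset n → Subset n → Set
  Shared P E = Nonempty E × (∃[ Q ] (MaxClique G Q × Q ≢ P × E ≡ P ∩ Q))

  Shared? : ∀ P E → Dec (Shared P E)
  Shared? P E = nonempty? E ×-dec anySubset? (λ Q → maxClique? Q ×-dec (¬? (Q ≟S P) ×-dec (E ≟S (P ∩ Q))))

  -- Choosing the intersection of P with another maximal clique as large as possible, any edge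
  -- of P leaving that intersection lies in no further maximal clique.
  private-edge : ∀ {P} → MaxClique G P →
    ∃[ x ] ∃[ y ] (x ∈ P × y ∈ P × x ~ y × (∀ Q → MaxClique G Q → x ∈ Q → y ∈ Q → Q ≡ P))
  private-edge {P} mP@(cP , maxP) with anySubset? (Shared? P)
  ... | no none with max-nonempty mP
  ...   | x , x∈ with other-element (proj₁ cP) x
  ...     | y , y∈ , y≢x = x , y , x∈ , y∈ , proj₂ cP x y x∈ y∈ (λ e → y≢x (≡-sym e)) , unique
    where
    unique : ∀ Q → MaxClique G Q → x ∈ Q → y ∈ Q → Q ≡ P
    unique Q mQ x∈Q _ with Q ≟S P
    ... | yes e = e
    ... | no ne = ⊥-elim (none (P ∩ Q , (x , x∈p∩q⁺ (x∈ , x∈Q)) , Q , mQ , ne , refl))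
  private-edge {P} mP@(cP , maxP) | yes (E₀ , sh₀) with maximal-above (Shared? P) sh₀
  ... | _ , _ , ((x , x∈E) , Q₁ , mQ₁ , Q₁≢P , refl) , max
    with ⊈⇒∃ {A = P} {Q₁} (λ P⊆Q₁ → Q₁≢P (maxP Q₁ (proj₁ mQ₁) P⊆Q₁)) | x∈p∩q⁻ P Q₁ x∈E
  ...   | y , y∈P , y∉Q₁ | x∈P , x∈Q₁ =
    x , y , x∈P , y∈P , proj₂ cP x y x∈P y∈P (λ { refl → y∉Q₁ x∈Q₁ }) , unique
    where
    unique : ∀ Q → MaxClique G Q → x ∈ Q → y ∈ Q → Q ≡ P
    unique Q mQ x∈Q y∈Q with Q ≟S P
    ... | yes e = e
    ... | no ne with ⊈⇒∃ {A = P ∩ Q₁} {P ∩ Q} (λ s → max (P ∩ Q) ((x , x∈p∩q⁺ (x∈P , x∈Q)) , Q , mQ , ne , refl)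
                       (s , y , x∈p∩q⁺ (y∈P , y∈Q) , λ h → y∉Q₁ (p∩q⊆q P Q₁ h)))
    ...   | w , w∈ , w∉ with x∈p∩q⁻ P Q₁ w∈
    ...     | w∈P , w∈Q₁ with nonneighbour mQ₁ y∉Q₁ | nonneighbour mQ (λ w∈Q → w∉ (x∈p∩q⁺ (w∈P , w∈Q)))
    ...       | q₁ , q₁∈ , y≁q₁ | q , q∈ , w≁q =
      ⊥-elim (no-gem′
        (proj₂ (proj₁ mQ₁) q₁ w q₁∈ w∈Q₁ (λ { refl → y≁q₁ (~-sym wy) })) wy
        (proj₂ (proj₁ mQ) y q y∈Q q∈ (λ { refl → w≁q wy }))
        (λ { refl → y∉Q₁ q₁∈ }) (λ e → y≁q₁ (~-sym e)) (λ { refl → w∉ (x∈p∩q⁺ (w∈P , q∈)) }) w≁q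
        (proj₁ mQ₁) (proj₁ mQ) q₁∈ x∈Q₁ x∈Q q∈)
      where
      wy : w ~ y
      wy = proj₂ cP w y w∈P y∈P (λ { refl → y∉Q₁ w∈Q₁ })

-- The digraph N(K(G))

⁅⁆-injective : ∀ {n} {x y : Fin n} → ⁅ x ⁆ ≡ ⁅ y ⁆ → x ≡ y
⁅⁆-injective {x = x} {y} e = x∈⁅y⁆⇒x≡y y (subst (x ∈_) e (x∈⁅x⁆ x))

module NDigraph {n} (G : Graph n) (2≤n : 2 ≤ n) (con : Connected G) where

  open Adjacency G
  open Closure (MaxClique G) public
  open Decide maxClique? public

  H : Subset n → Subset n → Set
  H = HArc 𝒞

  max⇒𝒞 : ∀ {Q} → MaxClique G Q → 𝒞 Q
  max⇒𝒞 m = K⇒𝒞 m (max-nonempty m)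

  private
    another : ∀ {k} → 2 ≤ k → (x : Fin k) → ∃[ y ] x ≢ y
    another (s≤s (s≤s _)) zero    = suc zero , λ ()
    another (s≤s (s≤s _)) (suc x) = zero , λ ()

  in-max : ∀ x → ∃[ Q ] (MaxClique G Q × x ∈ Q)
  in-max x with another 2≤n x
  ... | y , x≢y with con x y
  ...   | zero , wnil = ⊥-elim (x≢y refl)
  ...   | suc k , wcons e _ with edge⇒max e
  ...     | Q , mQ , x∈ , _ = Q , mQ , x∈

  Minimal : Subset n → Fin n → Set
  Minimal A x = x ∈ A × ¬ (∃[ C ] (H A C × x ∈ C))

  minimal-⊆ : ∀ {A C x} → 𝒞 A → Minimal A x → 𝒞 C → x ∈ C → A ⊆ C
  minimal-⊆ {A} {C} {x} cA (x∈A , none) cC x∈C with A ⊆? C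
  ... | yes s = s
  ... | no ¬s with ⊈⇒∃ {A = A} {C} ¬s
  ...   | y , y∈A , y∉C
    with cover-below (𝒞-∩ cA cC (x , x∈p∩q⁺ (x∈A , x∈C))) cA (p∩q⊆p A C , y , y∈A , λ h → y∉C (p∩q⊆q A C h))
  ...     | E , arc , s = ⊥-elim (none (E , arc , s (x∈p∩q⁺ (x∈A , x∈C))))

  minimal-exists : ∀ x → ∃[ A ] (𝒞 A × Minimal A x)
  minimal-exists x with in-max x
  ... | Q , mQ , x∈Q with minimal-below (λ C → 𝒞? C ×-dec (x ∈? C)) (max⇒𝒞 mQ , x∈Q)
  ...   | A , _ , (cA , x∈A) , min =
    A , cA , x∈A , λ (C , (_ , cC , C⊂A , _) , x∈C) → min C (cC , x∈C) C⊂A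

  arc₁-source : ∀ {A B} → Arc₁ 𝒞 A B → 𝒞 A
  arc₁-source (inj₁ (cA , _)) = cA
  arc₁-source (inj₂ (cA , _)) = cA

  arc₁-target : ∀ {A B} → Arc₁ 𝒞 A B → V₁ 𝒞 B
  arc₁-target (inj₁ (_ , cB , _)) = inj₁ cB
  arc₁-target (inj₂ (_ , x , e , ¬c , _)) = inj₂ (x , e , ¬c)

  arc₁-⊂ : ∀ {A B} → Arc₁ 𝒞 A B → B ⊂ A
  arc₁-⊂ (inj₁ (_ , _ , s , _)) = s
  arc₁-⊂ {A} (inj₂ (cA , x , refl , ¬c , x∈A , _)) with ⁅ x ⁆ ⊂? A
  ... | yes s = s
  ... | no ¬s = ⊥-elim (¬c (subst 𝒞 (⊆-antisym (⊆∧⊄⇒⊇ (⁅x⁆⊆ x∈A) ¬s) (⁅x⁆⊆ x∈A)) cA))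

  arc₁-pendant : ∀ {A B} → ¬ 𝒞 B → Arc₁ 𝒞 A B → 𝒞 A × ∃[ x ] (B ≡ ⁅ x ⁆ × Minimal A x)
  arc₁-pendant ¬c (inj₁ (_ , cB , _)) = ⊥-elim (¬c cB)
  arc₁-pendant ¬c (inj₂ (cA , x , e , _ , m)) = cA , x , e , m

  pendant-parent : ∀ {A A′ B} → ¬ 𝒞 B → Arc₁ 𝒞 A B → Arc₁ 𝒞 A′ B → A ≡ A′
  pendant-parent ¬c a a′ with arc₁-pendant ¬c a | arc₁-pendant ¬c a′
  ... | cA , x , refl , m | cA′ , x′ , e , m′ with ⁅⁆-injective e
  ...   | refl = ⊆-antisym (minimal-⊆ cA m cA′ (proj₁ m′)) (minimal-⊆ cA′ m′ cA (proj₁ m))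

  pd-closed : ∀ {A} → V₂ 𝒞 (pd A) → 𝒞 A
  pd-closed (inj₁ c , _) = c
  pd-closed (inj₂ (x , refl , ¬c) , _ , B , C , B≢C , b , c) = ⊥-elim (B≢C (pendant-parent ¬c b c))

  E₂ : NVert n → NVert n → Set
  E₂ = Und (Arc₂ 𝒞)

  arc₂-V₂ : ∀ {u v} → Arc₂ 𝒞 u v → V₂ 𝒞 u × V₂ 𝒞 v
  arc₂-V₂ {nd A} {nd B} a = inj₁ (arc₁-source a) , arc₁-target a
  arc₂-V₂ {nd A} {pd B} (refl , v) = proj₁ v , v

  E₂-V₂ : ∀ {u v} → E₂ u v → V₂ 𝒞 u × V₂ 𝒞 v
  E₂-V₂ (inj₁ a) = arc₂-V₂ a
  E₂-V₂ (inj₂ a) = let p , q = arc₂-V₂ a in q , p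

  private
    pendant-neighbour : ∀ {A B w} → ¬ 𝒞 B → Arc₁ 𝒞 A B → E₂ (nd B) w → w ≡ nd A
    pendant-neighbour {w = nd C} ¬c a (inj₁ b)          = ⊥-elim (¬c (arc₁-source b))
    pendant-neighbour {w = pd C} ¬c a (inj₁ (refl , v)) = ⊥-elim (¬c (pd-closed v))
    pendant-neighbour {w = nd C} ¬c a (inj₂ b)          = cong nd (pendant-parent ¬c b a)

    pd-neighbour : ∀ {A w} → E₂ (pd A) w → w ≡ nd A
    pd-neighbour {w = nd C} (inj₂ (refl , _)) = refl

    project : ∀ {A B C D} → 𝒞 C → 𝒞 D → UWalk (Cut E₂ (nd A) (nd B)) (nd C) (nd D) → UWalk (Cut (Und H) A B) C D
    project cC cD unil = unil
    project cC cD (ucons {w = nd C′} (inj₁ (inj₁ a) , p , q) w) =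
      ucons (inj₁ a , (λ { (refl , refl) → p (refl , refl) }) , (λ { (refl , refl) → q (refl , refl) }))
            (project (proj₁ (proj₂ a)) cD w)
    project cC cD (ucons {w = nd C′} (inj₁ (inj₂ (_ , x , refl , ¬c , _)) , _) unil) = ⊥-elim (¬c cD)
    project cC cD (ucons {w = nd C′} (inj₁ b@(inj₂ (_ , x , refl , ¬c , _)) , _) (ucons (e , _) w))
      with pendant-neighbour ¬c b e
    ... | refl = project cC cD w
    project cC cD (ucons {w = nd C′} (inj₂ (inj₁ a) , p , q) w) =
      ucons (inj₂ a , (λ { (refl , refl) → p (refl , refl) }) , (λ { (refl , refl) → q (refl , refl) }))
            (project (proj₁ a) cD w)
    project cC cD (ucons {w = nd C′} (inj₂ (inj₂ (_ , x , refl , ¬c , _)) , _) w) = ⊥-elim (¬c cC)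
    project cC cD (ucons {w = pd C′} (inj₁ (refl , v) , _) (ucons (e , _) w)) with pd-neighbour e
    ... | refl = project cC cD w

  module _ (ac : UAcyclic 𝒞 (Und H)) where

    private
      H-𝒞 : ∀ {A B} → Und H A B → 𝒞 A × 𝒞 B
      H-𝒞 (inj₁ (cA , cB , _)) = cA , cB
      H-𝒞 (inj₂ (cB , cA , _)) = cA , cB

      bridge : ∀ {u v} → Arc₂ 𝒞 u v → ¬ UWalk (Cut E₂ u v) v u
      bridge {nd A} {nd B} (inj₁ a@(cA , cB , (_ , x , x∈A , x∉B) , _)) w =
        acyclic⇒bridge H-𝒞 _≟S_ ac (inj₁ a) (λ { refl → x∉B x∈A }) (project cB cA w)
      bridge {nd A} {nd B} (inj₂ (cA , x , refl , ¬c , _)) unil = ¬c cA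
      bridge {nd A} {nd B} a@(inj₂ (cA , x , refl , ¬c , _)) (ucons (e , _ , q) w)
        with pendant-neighbour ¬c a e
      ... | refl = q (refl , refl)
      bridge {nd A} {pd B} (refl , _) (ucons (e , _ , q) w) with pd-neighbour e
      ... | refl = q (refl , refl)

    N-acyclic : UAcyclic (V₂ 𝒞) E₂
    N-acyclic cs cyc with cycle⇒detour cs cyc
    ... | u , v , inj₁ a , w = bridge a w
    ... | u , v , inj₂ a , w =
      bridge a (UWalk-map {E = Cut E₂ u v} (λ (e , p , q) → e , q , p)
        (UWalk-sym {E = Cut E₂ u v} (λ {x} {y} → Cut-sym {E = E₂} (λ {x} {y} → Und-sym {A = Arc₂ 𝒞} {x} {y}) {u} {v} {x} {y}) w))

  private
    ⊆-walk : ∀ f {C D} → ∣ D ∣ ≤ f → 𝒞 C → 𝒞 D → C ⊆ D → UWalk E₂ (nd D) (nd C)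
    ⊆-walk f {C} {D} le cC cD C⊆D with C ⊂? D
    ... | no ¬s with ⊆-antisym C⊆D (⊆∧⊄⇒⊇ C⊆D ¬s)
    ...   | refl = unil
    ⊆-walk f {C} {D} le cC cD C⊆D | yes s with cover-below cC cD s
    ... | E , arc@(_ , cE , E⊂D , _) , C⊆E with ≤-trans (p⊂q⇒∣p∣<∣q∣ E⊂D) le
    ...   | s≤s le′ = ucons (inj₁ (inj₁ arc)) (⊆-walk _ le′ cC cE C⊆E)

    meet-walk : ∀ {C D x} → 𝒞 C → 𝒞 D → x ∈ C → x ∈ D → UWalk E₂ (nd C) (nd D)
    meet-walk {C} {D} cC cD x∈C x∈D =
      ⊆-walk _ ≤-refl cM cC (p∩q⊆p C D) ++ᵤ UWalk-sym (λ {x} {y} → Und-sym {A = Arc₂ 𝒞} {x} {y}) (⊆-walk _ ≤-refl cM cD (p∩q⊆q C D))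
      where
      cM : 𝒞 (C ∩ D)
      cM = 𝒞-∩ cC cD (_ , x∈p∩q⁺ (x∈C , x∈D))

    graph-walk : ∀ {C D x y k} → 𝒞 C → 𝒞 D → x ∈ C → y ∈ D → Walk G x y k → UWalk E₂ (nd C) (nd D)
    graph-walk cC cD x∈ y∈ wnil = meet-walk cC cD x∈ y∈
    graph-walk cC cD x∈ y∈ (wcons e w) with edge⇒max e
    ... | Q , mQ , x∈Q , z∈Q = meet-walk cC (max⇒𝒞 mQ) x∈ x∈Q ++ᵤ graph-walk (max⇒𝒞 mQ) cD z∈Q y∈ w

    to-closed : ∀ v → V₂ 𝒞 v → ∃[ C ] (𝒞 C × UWalk E₂ v (nd C))
    to-closed (nd A) (inj₁ c) = A , c , unil
    to-closed (nd A) (inj₂ (x , refl , ¬c)) with minimal-exists x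
    ... | C , cC , m = C , cC , ucons (inj₂ (inj₂ (cC , x , refl , ¬c , m))) unil
    to-closed (pd A) v = A , pd-closed v , ucons (inj₂ (refl , v)) unil

  N-connected : UConnected (V₂ 𝒞) E₂
  N-connected u v Vu Vv with to-closed u Vu | to-closed v Vv
  ... | C , cC , w | D , cD , w′ with nonempty cC | nonempty cD
  ...   | x , x∈ | y , y∈ =
    w ++ᵤ (graph-walk cC cD x∈ y∈ (proj₂ (con x y)) ++ᵤ UWalk-sym (λ {x} {y} → Und-sym {A = Arc₂ 𝒞} {x} {y}) w′)

  H-acyclic⇒N-arboreal : UAcyclic 𝒞 (Und H) → NArboreal (MaxClique G)
  H-acyclic⇒N-arboreal ac = N-connected , N-acyclic ac

-- Counting

countF-zero : ∀ {m} (f : Fin m → Bool) → (∀ i → f i ≢ true) → countF f ≡ 0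
countF-zero f h with countF f in e
... | zero  = refl
... | suc k with countF-witness f (subst (1 ≤_) (≡-sym e) (s≤s z≤n))
...   | i , t = ⊥-elim (h i t)

trues : ∀ {m} → (Fin m → Bool) → List (Fin m)
trues {zero}  f = []
trues {suc m} f = (if f zero then zero ∷_ else λ is → is) (map suc (trues (λ i → f (suc i))))

length-trues : ∀ {m} (f : Fin m → Bool) → length (trues f) ≡ countF f
length-trues {zero}  f = refl
length-trues {suc m} f with f zero
... | true  = cong suc (≡-trans (length-map suc (trues (λ i → f (suc i)))) (length-trues (λ i → f (suc i))))
... | false = ≡-trans (length-map suc (trues (λ i → f (suc i)))) (length-trues (λ i → f (suc i)))

∈-trues⁺ : ∀ {m} (f : Fin m → Bool) {i} → f i ≡ true → i ∈ₗ trues f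
∈-trues⁺ {suc m} f {zero}  e rewrite e = here refl
∈-trues⁺ {suc m} f {suc i} e with f zero
... | true  = there (∈-map⁺ suc (∈-trues⁺ (λ i → f (suc i)) e))
... | false = ∈-map⁺ suc (∈-trues⁺ (λ i → f (suc i)) e)

∈-trues⁻ : ∀ {m} (f : Fin m → Bool) {i} → i ∈ₗ trues f → f i ≡ true
∈-trues⁻ {suc m} f i∈ with f zero in e
∈-trues⁻ {suc m} f (here refl) | true = e
∈-trues⁻ {suc m} f (there i∈) | true with ∈-map⁻ suc i∈
... | j , j∈ , refl = ∈-trues⁻ (λ i → f (suc i)) j∈
∈-trues⁻ {suc m} f i∈ | false with ∈-map⁻ suc i∈
... | j , j∈ , refl = ∈-trues⁻ (λ i → f (suc i)) j∈

trues-unique : ∀ {m} (f : Fin m → Bool) → Unique (trues f)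
trues-unique {zero}  f = []
trues-unique {suc m} f with f zero
... | true  = All.map⁺ (All.universal (λ _ ()) _) ∷ Unique.map⁺ Fin.suc-injective (trues-unique (λ i → f (suc i)))
... | false = Unique.map⁺ Fin.suc-injective (trues-unique (λ i → f (suc i)))

module _ {A B : Set} (R : A → B → Set) (R-inj : ∀ {x x′ y} → R x y → R x′ y → x ≡ x′) where

  matching-length : ∀ {xs ys} → Unique xs → (∀ {x} → x ∈ₗ xs → ∃[ y ] (y ∈ₗ ys × R x y)) → length xs ≤ length ys
  matching-length [] h = z≤n
  matching-length {x ∷ xs} (x∉ ∷ un) h with h (here refl)
  ... | y , y∈ , r with ∈-∃++ y∈
  ...   | as , bs , refl =
    ≤-trans (s≤s (matching-length un rest))
      (≤-reflexive (≡-trans (cong suc (length-++ as)) (≡-trans (≡-sym (+-suc (length as) (length bs))) (≡-sym (length-++ as)))))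
    where
    rest : ∀ {x′} → x′ ∈ₗ xs → ∃[ y′ ] (y′ ∈ₗ (as ++ bs) × R x′ y′)
    rest x′∈ with h (there x′∈)
    ... | y′ , y′∈ , r′ with ∈-++⁻ as y′∈
    ...   | inj₁ i         = y′ , ∈-++⁺ˡ i , r′
    ...   | inj₂ (there i) = y′ , ∈-++⁺ʳ as i , r′
    ...   | inj₂ (here refl) = ⊥-elim (All.lookup x∉ x′∈ (R-inj r r′))

countF-≥2 : ∀ {m} (f : Fin m → Bool) {i j} → i ≢ j → f i ≡ true → f j ≡ true → 2 ≤ countF f
countF-≥2 f {i} {j} i≢j p q =
  ≤-trans (matching-length _≡_ (λ { refl refl → refl }) {i ∷ j ∷ []} {trues f} ((i≢j ∷ []) ∷ [] ∷ [])
            (λ { (here refl) → i , ∈-trues⁺ f p , refl ; (there (here refl)) → j , ∈-trues⁺ f q , refl }))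
    (≤-reflexive (length-trues f))

countF-one : ∀ {m} (f : Fin m → Bool) {i} → f i ≡ true → (∀ j → f j ≡ true → j ≡ i) → countF f ≡ 1
countF-one f {i} p h = ≤-antisym
  (≤-trans (≤-reflexive (≡-sym (length-trues f)))
    (matching-length _≡_ (λ { refl refl → refl }) {trues f} {i ∷ []} (trues-unique f)
      (λ {j} j∈ → j , here (h j (∈-trues⁻ f j∈)) , refl)))
  (countF-≥1 f i p)

lookup-injective : ∀ {A : Set} {xs : List A} → Unique xs → ∀ i j → lookup xs i ≡ lookup xs j → i ≡ j
lookup-injective (x∉ ∷ un) zero    zero    e = refl
lookup-injective (x∉ ∷ un) zero    (suc j) e = ⊥-elim (All.lookup x∉ (∈-lookup j) e)
lookup-injective (x∉ ∷ un) (suc i) zero    e = ⊥-elim (All.lookup x∉ (∈-lookup i) (≡-sym e))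
lookup-injective (x∉ ∷ un) (suc i) (suc j) e = cong suc (lookup-injective un i j e)

subsets : ∀ n → List (Subset n)
subsets zero    = []ᵥ ∷ []
subsets (suc n) = map (inside ∷ᵥ_) (subsets n) ++ map (outside ∷ᵥ_) (subsets n)

∈-subsets : ∀ {n} (A : Subset n) → A ∈ₗ subsets n
∈-subsets []ᵥ = here refl
∈-subsets (true  ∷ᵥ A) = ∈-++⁺ˡ (∈-map⁺ (inside ∷ᵥ_) (∈-subsets A))
∈-subsets {suc n} (false ∷ᵥ A) = ∈-++⁺ʳ (map (inside ∷ᵥ_) (subsets n)) (∈-map⁺ (outside ∷ᵥ_) (∈-subsets A))

module _ {A : Set} (_≟_ : DecidableEquality A) (all : List A) (complete : ∀ a → a ∈ₗ all) {P : A → Set} (P? : Decidable P) where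

  satisfying : List A
  satisfying = filter P? (deduplicate _≟_ all)

  satisfying-unique : Unique satisfying
  satisfying-unique = Unique.filter⁺ P? (UniqueDec.deduplicate-! _≟_ all)

  ∈-satisfying⁺ : ∀ {a} → P a → a ∈ₗ satisfying
  ∈-satisfying⁺ {a} = ∈-filter⁺ P? (∈-deduplicate⁺ _≟_ (complete a))

  ∈-satisfying⁻ : ∀ {a} → a ∈ₗ satisfying → P a
  ∈-satisfying⁻ a∈ = proj₂ (∈-filter⁻ P? {xs = deduplicate _≟_ all} a∈)

module _ {V W : Set} {E : V → V → Set} {F : W → W → Set} (f : W → V) where

  private
    chain-map : (∀ {i j} → F i j → E (f i) (f j)) → ∀ w ws {v} → ClosedChain F v (w ∷ ws) → ClosedChain E (f v) (map f (w ∷ ws))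
    chain-map h w []        e       = h e
    chain-map h w (w′ ∷ ws) (e , c) = h e , chain-map h w′ ws c

  acyclic-pullback : {Vt : V → Set} {Wt : W → Set} → (∀ {i j} → f i ≡ f j → i ≡ j) → (∀ i → Vt (f i)) →
    (∀ {i j} → F i j → E (f i) (f j)) → UAcyclic Vt E → UAcyclic Wt F
  acyclic-pullback inj vt h ac (w ∷ ws) (le , un , _ , c) =
    ac (map f (w ∷ ws)) (subst (3 ≤_) (≡-sym (length-map f (w ∷ ws))) le , Unique.map⁺ inj un ,
      All.map⁺ {xs = w ∷ ws} (All.universal vt (w ∷ ws)) , chain-map h w ws c)

-- The network N(K(G))

does-true⁻ : ∀ {P : Set} (d : Dec P) → does d ≡ true → P
does-true⁻ (yes p) _ = p

module Construction {n} (G : Graph n) (2≤n : 2 ≤ n) (con : Connected G) where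

  open Adjacency G
  open NDigraph G 2≤n con

  abstract
    HArc? : ∀ A B → Dec (H A B)
    HArc? A B = 𝒞? A ×-dec (𝒞? B ×-dec ((B ⊂? A) ×-dec ¬? (anySubset? (λ C → 𝒞? C ×-dec ((B ⊂? C) ×-dec (C ⊂? A))))))

    Arc₁? : ∀ A B → Dec (Arc₁ 𝒞 A B)
    Arc₁? A B = HArc? A B ⊎-dec (𝒞? A ×-dec any? (λ x → (B ≟S ⁅ x ⁆) ×-dec (¬? (𝒞? ⁅ x ⁆) ×-dec ((x ∈? A) ×-dec
      ¬? (anySubset? (λ C → HArc? A C ×-dec (x ∈? C)))))))

    V₁? : ∀ A → Dec (V₁ 𝒞 A)
    V₁? A = 𝒞? A ⊎-dec any? (λ x → (A ≟S ⁅ x ⁆) ×-dec ¬? (𝒞? ⁅ x ⁆))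

    V₂? : ∀ v → Dec (V₂ 𝒞 v)
    V₂? (nd A) = V₁? A
    V₂? (pd A) = V₁? A ×-dec
      (map′ (λ h B a → h (B , a)) (λ h (B , a) → h B a) (¬? (anySubset? (Arc₁? A))) ×-dec
       anySubset? (λ B → anySubset? (λ C → ¬? (B ≟S C) ×-dec (Arc₁? B A ×-dec Arc₁? C A))))

    Arc₂? : ∀ u v → Dec (Arc₂ 𝒞 u v)
    Arc₂? (nd A) (nd B) = Arc₁? A B
    Arc₂? (nd A) (pd B) = (A ≟S B) ×-dec V₂? (pd B)
    Arc₂? (pd A) v      = no (λ ())

  _≟N_ : DecidableEquality (NVert n)
  nd A ≟N nd B = map′ (cong nd) (λ { refl → refl }) (A ≟S B)
  pd A ≟N pd B = map′ (cong pd) (λ { refl → refl }) (A ≟S B)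
  nd A ≟N pd B = no (λ ())
  pd A ≟N nd B = no (λ ())

  allVertices : List (NVert n)
  allVertices = map nd (subsets n) ++ map pd (subsets n)

  ∈-allVertices : ∀ v → v ∈ₗ allVertices
  ∈-allVertices (nd A) = ∈-++⁺ˡ (∈-map⁺ nd (∈-subsets A))
  ∈-allVertices (pd A) = ∈-++⁺ʳ (map nd (subsets n)) (∈-map⁺ pd (∈-subsets A))

  abstract
    L : List (NVert n)
    L = satisfying _≟N_ allVertices ∈-allVertices V₂?

    L-unique : Unique L
    L-unique = satisfying-unique _≟N_ allVertices ∈-allVertices V₂?

    ∈-L⁺ : ∀ {v} → V₂ 𝒞 v → v ∈ₗ L
    ∈-L⁺ = ∈-satisfying⁺ _≟N_ allVertices ∈-allVertices V₂?

    ∈-L⁻ : ∀ {v} → v ∈ₗ L → V₂ 𝒞 v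
    ∈-L⁻ = ∈-satisfying⁻ _≟N_ allVertices ∈-allVertices V₂?

  at : Fin (length L) → NVert n
  at = lookup L

  at-V₂ : ∀ i → V₂ 𝒞 (at i)
  at-V₂ i = ∈-L⁻ (∈-lookup i)

  at-injective : ∀ {i j} → at i ≡ at j → i ≡ j
  at-injective = lookup-injective L-unique _ _

  position : ∀ v → V₂ 𝒞 v → ∃[ i ] at i ≡ v
  position v Vv = index (∈-L⁺ Vv) , ≡-sym (Any.lookup-index (∈-L⁺ Vv))

  arcN : Fin (length L) → Fin (length L) → Bool
  arcN i j = does (Arc₂? (at i) (at j))

  arcN⁺ : ∀ {i j} → Arc₂ 𝒞 (at i) (at j) → arcN i j ≡ true
  arcN⁺ {i} {j} a = dec-true (Arc₂? (at i) (at j)) a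

  arcN⁻ : ∀ {i j} → arcN i j ≡ true → Arc₂ 𝒞 (at i) (at j)
  arcN⁻ {i} {j} = does-true⁻ (Arc₂? (at i) (at j))

  indegN outdegN : Fin (length L) → ℕ
  indegN  i = countF (λ j → arcN j i)
  outdegN i = countF (arcN i)

  walk-position : {E : NVert n → NVert n → Set} {F : Fin (length L) → Fin (length L) → Set} →
    (∀ {u v} → E u v → V₂ 𝒞 v) → (∀ {i j} → E (at i) (at j) → F i j) →
    ∀ {u v} → UWalk E u v → ∀ i j → at i ≡ u → at j ≡ v → UWalk F i j
  walk-position vt h unil i j p q with at-injective (≡-trans p (≡-sym q))
  ... | refl = unil
  walk-position vt h (ucons {w = w} e p) i j refl q with position w (vt e)
  ... | k , refl = ucons (h e) (walk-position vt h p k j refl q)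

  carrier : NVert n → Subset n
  carrier (nd A) = A
  carrier (pd A) = A

  child : ∀ {A x} → 𝒞 A → 2 ≤ ∣ A ∣ → x ∈ A → ∃[ B ] (Arc₁ 𝒞 A B × x ∈ B)
  child {A} {x} cA le x∈A with anySubset? (λ C → HArc? A C ×-dec (x ∈? C))
  ... | yes (C , arc , x∈C) = C , inj₁ arc , x∈C
  ... | no none = ⁅ x ⁆ , inj₂ (cA , x , refl , ¬c , x∈A , none) , x∈⁅x⁆ x
    where
    ¬c : ¬ 𝒞 ⁅ x ⁆
    ¬c c with other-element le x
    ... | y , y∈ , y≢x with cover-below c cA (⁅x⁆⊆ x∈A , y , y∈ , λ h → y≢x (x∈⁅y⁆⇒x≡y x h))
    ...   | E , arc , s = none (E , arc , s (x∈⁅x⁆ x))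

  two-children : ∀ {A} → 𝒞 A → 2 ≤ ∣ A ∣ → ∃[ B ] ∃[ C ] (B ≢ C × Arc₁ 𝒞 A B × Arc₁ 𝒞 A C)
  two-children cA le with nonempty cA
  ... | x , x∈ with child cA le x∈
  ...   | B , b , _ with arc₁-⊂ b
  ...     | _ , y , y∈ , y∉ with child cA le y∈
  ...       | C , c , y∈C = B , C , (λ { refl → y∉ y∈C }) , b , c

  V₁-nonempty : ∀ {A} → V₁ 𝒞 A → Nonempty A
  V₁-nonempty (inj₁ c) = nonempty c
  V₁-nonempty (inj₂ (x , refl , _)) = x , x∈⁅x⁆ x

  singleton-sink : ∀ {x B} → ¬ Arc₁ 𝒞 ⁅ x ⁆ B
  singleton-sink {x} a with arc₁-⊂ a | V₁-nonempty (arc₁-target a)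
  ... | s , z , z∈ , z∉ | y , y∈ =
    z∉ (subst (_∈ _) (≡-trans (x∈⁅y⁆⇒x≡y x (s y∈)) (≡-sym (x∈⁅y⁆⇒x≡y x z∈))) y∈)

  ⁅x⁆⊂max : ∀ {Q x} → MaxClique G Q → x ∈ Q → ⁅ x ⁆ ⊂ Q
  ⁅x⁆⊂max {x = x} mQ x∈Q with other-element (proj₁ (proj₁ mQ)) x
  ... | y , y∈ , y≢x = ⁅x⁆⊆ x∈Q , y , y∈ , λ h → y≢x (x∈⁅y⁆⇒x≡y x h)

  singleton-parents : ∀ {x} → 𝒞 ⁅ x ⁆ → ∃[ B ] ∃[ C ] (B ≢ C × Arc₁ 𝒞 B ⁅ x ⁆ × Arc₁ 𝒞 C ⁅ x ⁆)
  singleton-parents {x} c with in-max x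
  ... | Q , mQ , x∈Q with cover-above c (max⇒𝒞 mQ) (⁅x⁆⊂max mQ x∈Q)
  ...   | E , arc@(_ , _ , (_ , e , e∈E , e∉) , _) , _ with avoid c e∉
  ...     | Q′ , mQ′ , s , e∉Q′ with cover-above c (max⇒𝒞 mQ′) (⁅x⁆⊂max mQ′ (s (x∈⁅x⁆ x)))
  ...       | E′ , arc′ , s′ = E , E′ , (λ { refl → e∉Q′ (s′ e∈E) }) , inj₁ arc , inj₁ arc′

  singleton-pd : ∀ {x} → 𝒞 ⁅ x ⁆ → V₂ 𝒞 (pd ⁅ x ⁆)
  singleton-pd c = inj₁ c , (λ B → singleton-sink) , singleton-parents c

  singleton⊎large : ∀ {A} → 𝒞 A → 2 ≤ ∣ A ∣ ⊎ (∃[ x ] A ≡ ⁅ x ⁆)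
  singleton⊎large {A} cA with nonempty cA
  ... | x , x∈ with A ≟S ⁅ x ⁆
  ...   | yes e = inj₂ (x , e)
  ...   | no ne with ⊈⇒∃ {A = A} {⁅ x ⁆} (λ s → ne (⊆-antisym s (⁅x⁆⊆ x∈)))
  ...     | y , y∈ , y∉ = inj₁ (two-elements x∈ y∈ (λ { refl → y∉ (x∈⁅x⁆ x) }))

  leafV : Fin n → NVert n
  leafV x with 𝒞? ⁅ x ⁆
  ... | yes _ = pd ⁅ x ⁆
  ... | no _  = nd ⁅ x ⁆

  leafV-pd : ∀ {x} → 𝒞 ⁅ x ⁆ → leafV x ≡ pd ⁅ x ⁆
  leafV-pd {x} c with 𝒞? ⁅ x ⁆
  ... | yes _ = refl
  ... | no ¬c = ⊥-elim (¬c c)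

  leafV-nd : ∀ {x} → ¬ 𝒞 ⁅ x ⁆ → leafV x ≡ nd ⁅ x ⁆
  leafV-nd {x} ¬c with 𝒞? ⁅ x ⁆
  ... | yes c = ⊥-elim (¬c c)
  ... | no _  = refl

  leafV-carrier : ∀ x → carrier (leafV x) ≡ ⁅ x ⁆
  leafV-carrier x with 𝒞? ⁅ x ⁆
  ... | yes _ = refl
  ... | no _  = refl

  leafV-V₂ : ∀ x → V₂ 𝒞 (leafV x)
  leafV-V₂ x with 𝒞? ⁅ x ⁆
  ... | yes c = singleton-pd c
  ... | no ¬c = inj₂ (x , refl , ¬c)

  leafN : Fin n → Fin (length L)
  leafN x = proj₁ (position (leafV x) (leafV-V₂ x))

  at-leafN : ∀ x → at (leafN x) ≡ leafV x
  at-leafN x = proj₂ (position (leafV x) (leafV-V₂ x))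

  data Degrees (i : Fin (length L)) : Set where
    branching : ∀ {A} → at i ≡ nd A → 𝒞 A → 2 ≤ outdegN i → Degrees i
    joining   : 2 ≤ indegN i → 1 ≤ outdegN i → Degrees i
    pendant   : ∀ x → leafN x ≡ i → Degrees i

  private
    out-≥2 : ∀ i {u v} → u ≢ v → Arc₂ 𝒞 (at i) u → Arc₂ 𝒞 (at i) v → 2 ≤ outdegN i
    out-≥2 i {u} {v} u≢v a b with position u (proj₂ (arc₂-V₂ {at i} {u} a)) | position v (proj₂ (arc₂-V₂ {at i} {v} b))
    ... | j , refl | k , refl = countF-≥2 (arcN i) (λ { refl → u≢v refl }) (arcN⁺ {i} {j} a) (arcN⁺ {i} {k} b)

    in-≥2 : ∀ i {u v} → u ≢ v → Arc₂ 𝒞 u (at i) → Arc₂ 𝒞 v (at i) → 2 ≤ indegN i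
    in-≥2 i {u} {v} u≢v a b with position u (proj₁ (arc₂-V₂ {u} {at i} a)) | position v (proj₁ (arc₂-V₂ {v} {at i} b))
    ... | j , refl | k , refl = countF-≥2 (λ j → arcN j i) (λ { refl → u≢v refl }) (arcN⁺ {j} {i} a) (arcN⁺ {k} {i} b)

    out-≥1 : ∀ i {u} → Arc₂ 𝒞 (at i) u → 1 ≤ outdegN i
    out-≥1 i {u} a with position u (proj₂ (arc₂-V₂ {at i} {u} a))
    ... | j , refl = countF-≥1 (arcN i) j (arcN⁺ {i} {j} a)

    in-≥1 : ∀ i {u} → Arc₂ 𝒞 u (at i) → 1 ≤ indegN i
    in-≥1 i {u} a with position u (proj₁ (arc₂-V₂ {u} {at i} a))
    ... | j , refl = countF-≥1 (λ j → arcN j i) j (arcN⁺ {j} {i} a)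

    in-1 : ∀ i {u} → Arc₂ 𝒞 u (at i) → (∀ v → Arc₂ 𝒞 v (at i) → v ≡ u) → indegN i ≡ 1
    in-1 i {u} a h with position u (proj₁ (arc₂-V₂ {u} {at i} a))
    ... | j , refl = countF-one (λ j → arcN j i) (arcN⁺ {j} {i} a) (λ k e → at-injective (h (at k) (arcN⁻ {k} {i} e)))

    out-0 : ∀ i → (∀ v → ¬ Arc₂ 𝒞 (at i) v) → outdegN i ≡ 0
    out-0 i h = countF-zero (arcN i) (λ j e → h (at j) (arcN⁻ {i} {j} e))

    branch : ∀ i {A} → at i ≡ nd A → 𝒞 A → 2 ≤ ∣ A ∣ → Degrees i
    branch i e cA le with two-children cA le
    ... | B , C , B≢C , b , c = branching e cA
      (out-≥2 i {nd B} {nd C} (λ { refl → B≢C refl }) (subst (λ v → Arc₂ 𝒞 v (nd B)) (≡-sym e) b) (subst (λ v → Arc₂ 𝒞 v (nd C)) (≡-sym e) c))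

    parents-≥2 : ∀ i {A} → at i ≡ nd A → (∃[ B ] ∃[ C ] (B ≢ C × Arc₁ 𝒞 B A × Arc₁ 𝒞 C A)) → 2 ≤ indegN i
    parents-≥2 i e (B , C , B≢C , b , c) =
      in-≥2 i {nd B} {nd C} (λ { refl → B≢C refl }) (subst (Arc₂ 𝒞 (nd B)) (≡-sym e) b) (subst (Arc₂ 𝒞 (nd C)) (≡-sym e) c)

    join : ∀ i {x} → at i ≡ nd ⁅ x ⁆ → 𝒞 ⁅ x ⁆ → Degrees i
    join i {x} e c = joining (parents-≥2 i e (singleton-parents c))
      (out-≥1 i {pd ⁅ x ⁆} (subst (λ v → Arc₂ 𝒞 v (pd ⁅ x ⁆)) (≡-sym e) (refl , singleton-pd c)))

    leaf-nd : ∀ i {x} → at i ≡ nd ⁅ x ⁆ → ¬ 𝒞 ⁅ x ⁆ → indegN i ≡ 1 × outdegN i ≡ 0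
    leaf-nd i {x} e ¬c with minimal-exists x
    ... | A , cA , m =
      in-1 i {nd A} (subst (Arc₂ 𝒞 (nd A)) (≡-sym e) a) (λ v b → parent v (subst (Arc₂ 𝒞 v) e b)) ,
      out-0 i (λ v b → no-child v (subst (λ u → Arc₂ 𝒞 u v) e b))
      where
      a : Arc₁ 𝒞 A ⁅ x ⁆
      a = inj₂ (cA , x , refl , ¬c , m)
      parent : ∀ v → Arc₂ 𝒞 v (nd ⁅ x ⁆) → v ≡ nd A
      parent (nd B) b = cong nd (pendant-parent ¬c b a)
      no-child : ∀ v → ¬ Arc₂ 𝒞 (nd ⁅ x ⁆) v
      no-child (nd B) b = ¬c (arc₁-source b)
      no-child (pd B) (refl , v) = ¬c (pd-closed v)

    leaf-pd : ∀ i {x} → at i ≡ pd ⁅ x ⁆ → 𝒞 ⁅ x ⁆ → indegN i ≡ 1 × outdegN i ≡ 0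
    leaf-pd i {x} e c =
      in-1 i {nd ⁅ x ⁆} (subst (Arc₂ 𝒞 (nd ⁅ x ⁆)) (≡-sym e) (refl , singleton-pd c)) (λ v b → parent v (subst (Arc₂ 𝒞 v) e b)) ,
      out-0 i (λ v b → subst (λ u → Arc₂ 𝒞 u v) e b)
      where
      parent : ∀ v → Arc₂ 𝒞 v (pd ⁅ x ⁆) → v ≡ nd ⁅ x ⁆
      parent (nd B) (refl , _) = refl

  leaf-degrees : ∀ x → indegN (leafN x) ≡ 1 × outdegN (leafN x) ≡ 0
  leaf-degrees x = by-cases (𝒞? ⁅ x ⁆)
    where
    by-cases : Dec (𝒞 ⁅ x ⁆) → indegN (leafN x) ≡ 1 × outdegN (leafN x) ≡ 0
    by-cases (yes c) = leaf-pd (leafN x) (≡-trans (at-leafN x) (leafV-pd c)) c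
    by-cases (no ¬c) = leaf-nd (leafN x) (≡-trans (at-leafN x) (leafV-nd ¬c)) ¬c

  degrees : ∀ i → Degrees i
  degrees i = go (at i) refl (at-V₂ i)
    where
    go : ∀ v → at i ≡ v → V₂ 𝒞 v → Degrees i
    go (nd A) e (inj₁ cA) with singleton⊎large cA
    ... | inj₁ le         = branch i e cA le
    ... | inj₂ (x , refl) = join i e cA
    go (nd A) e (inj₂ (x , refl , ¬c)) =
      pendant x (at-injective (≡-trans (at-leafN x) (≡-trans (leafV-nd ¬c) (≡-sym e))))
    go (pd A) e v@(_ , sink , _) with singleton⊎large (pd-closed v)
    ... | inj₂ (x , refl) =
      pendant x (at-injective (≡-trans (at-leafN x) (≡-trans (leafV-pd (pd-closed v)) (≡-sym e))))
    ... | inj₁ le with two-children (pd-closed v) le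
    ...   | B , _ , _ , b , _ = ⊥-elim (sink B b)

  size : NVert n → ℕ
  size (nd A) = ∣ A ∣
  size (pd A) = 0

  size-decreases : ∀ {u v} → Arc₂ 𝒞 u v → size v < size u
  size-decreases {nd A} {nd B} a = p⊂q⇒∣p∣<∣q∣ (arc₁-⊂ a)
  size-decreases {nd A} {pd B} (refl , v) with nonempty (pd-closed v)
  ... | x , x∈ = subst (_≤ ∣ A ∣) (∣⁅x⁆∣≡1 x) (p⊆q⇒∣p∣≤∣q∣ (⁅x⁆⊆ x∈))

  carrier-decreases : ∀ {u v} → Arc₂ 𝒞 u v → carrier v ⊆ carrier u
  carrier-decreases {nd A} {nd B} a = proj₁ (arc₁-⊂ a)
  carrier-decreases {nd A} {pd B} (refl , _) = λ x → x

  reach-size : ∀ {i j} → Reach arcN i j → size (at j) ≤ size (at i)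
  reach-size rnil = ≤-refl
  reach-size {i} (rcons {w = w} a r) =
    ≤-trans (reach-size r) (≤-trans (n≤1+n _) (size-decreases {at i} {at w} (arcN⁻ {i} {w} a)))

  reach-carrier : ∀ {i j} → Reach arcN i j → carrier (at j) ⊆ carrier (at i)
  reach-carrier rnil = λ x → x
  reach-carrier {i} (rcons {w = w} a r) = λ x → carrier-decreases {at i} {at w} (arcN⁻ {i} {w} a) (reach-carrier r x)

  private
    to-leaf : ∀ f {A x} → ∣ A ∣ ≤ f → 𝒞 A → x ∈ A → UWalk (Arc₂ 𝒞) (nd A) (leafV x)
    to-leaf f {A} {x} le cA x∈A with singleton⊎large cA
    ... | inj₂ (y , refl) with x∈⁅y⁆⇒x≡y y x∈A
    ...   | refl = subst (UWalk (Arc₂ 𝒞) (nd ⁅ x ⁆)) (≡-sym (leafV-pd cA)) (ucons (refl , singleton-pd cA) unil)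
    to-leaf f {A} {x} le cA x∈A | inj₁ 2≤ with child cA 2≤ x∈A
    ... | B , b , x∈B with arc₁-target b
    ...   | inj₂ (y , refl , ¬c) with x∈⁅y⁆⇒x≡y y x∈B
    ...     | refl = subst (UWalk (Arc₂ 𝒞) (nd A)) (≡-sym (leafV-nd ¬c)) (ucons b unil)
    to-leaf f {A} {x} le cA x∈A | inj₁ 2≤ | B , b , x∈B | inj₁ cB with ≤-trans (p⊂q⇒∣p∣<∣q∣ (arc₁-⊂ b)) le
    ... | s≤s le′ = ucons b (to-leaf _ le′ cB x∈B)

    UWalk⇒Reach : ∀ {i j} → UWalk (λ i j → arcN i j ≡ true) i j → Reach arcN i j
    UWalk⇒Reach unil        = rnil
    UWalk⇒Reach (ucons e w) = rcons e (UWalk⇒Reach w)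

  E₂⇒arcN : ∀ {i j} → E₂ (at i) (at j) → Und (λ i j → arcN i j ≡ true) i j
  E₂⇒arcN {i} {j} (inj₁ a) = inj₁ (arcN⁺ {i} {j} a)
  E₂⇒arcN {i} {j} (inj₂ a) = inj₂ (arcN⁺ {j} {i} a)

  arcN⇒E₂ : ∀ {i j} → Und (λ i j → arcN i j ≡ true) i j → E₂ (at i) (at j)
  arcN⇒E₂ {i} {j} (inj₁ a) = inj₁ (arcN⁻ {i} {j} a)
  arcN⇒E₂ {i} {j} (inj₂ a) = inj₂ (arcN⁻ {j} {i} a)

  network-connected : UConnected (λ _ → ⊤) (Und (λ i j → arcN i j ≡ true))
  network-connected i j _ _ =
    walk-position {E = E₂} (λ {u} {v} e → proj₂ (E₂-V₂ {u} {v} e)) (λ {i} {j} → E₂⇒arcN {i} {j})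
      (N-connected (at i) (at j) (at-V₂ i) (at-V₂ j)) i j refl refl

  network : Network n
  network = record
    { m = length L
    ; arc = arcN
    ; leaf = leafN
    ; loopless = λ v → Bool.¬-not (λ e → <⇒≢ (size-decreases {at v} {at v} (arcN⁻ {v} {v} e)) refl)
    ; acyclic = λ u v a r → <⇒≱ (size-decreases {at u} {at v} (arcN⁻ {u} {v} a)) (reach-size r)
    ; connected = network-connected
    ; leaf-inj = λ x y e → ⁅⁆-injective (≡-trans (≡-sym (leafV-carrier x))
        (≡-trans (cong carrier (≡-trans (≡-sym (at-leafN x)) (≡-trans (cong at e) (at-leafN y)))) (leafV-carrier y)))
    ; leaves = λ v → mk⇔ (is-leaf v) (λ { (x , refl) → leaf-degrees x })
    ; root-outdeg = root
    ; sink-indeg = sink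
    ; no-subdivided = no-sub
    }
    where
    is-leaf : ∀ v → indegN v ≡ 1 × outdegN v ≡ 0 → ∃[ x ] leafN x ≡ v
    is-leaf v (i1 , o0) with degrees v
    ... | branching _ _ o≥2 = ⊥-elim (<⇒≱ o≥2 (≤-trans (≤-reflexive o0) z≤n))
    ... | joining _ o≥1     = ⊥-elim (<⇒≱ o≥1 (≤-reflexive o0))
    ... | pendant x e       = x , e
    root : ∀ v → indegN v ≡ 0 → 2 ≤ outdegN v
    root v i0 with degrees v
    ... | branching _ _ o≥2 = o≥2
    ... | joining i≥2 _     = ⊥-elim (<⇒≱ i≥2 (≤-trans (≤-reflexive i0) z≤n))
    ... | pendant x refl    = ⊥-elim (<⇒≢ (s≤s z≤n) (≡-trans (≡-sym i0) (proj₁ (leaf-degrees x))))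
    sink : ∀ v → outdegN v ≡ 0 → indegN v ≡ 1
    sink v o0 with degrees v
    ... | branching _ _ o≥2 = ⊥-elim (<⇒≱ o≥2 (≤-trans (≤-reflexive o0) z≤n))
    ... | joining _ o≥1     = ⊥-elim (<⇒≱ o≥1 (≤-reflexive o0))
    ... | pendant x refl    = proj₁ (leaf-degrees x)
    no-sub : ∀ v → ¬ (indegN v ≡ 1 × outdegN v ≡ 1)
    no-sub v (i1 , o1) with degrees v
    ... | branching _ _ o≥2 = <⇒≱ o≥2 (≤-reflexive o1)
    ... | joining i≥2 _     = <⇒≱ i≥2 (≤-reflexive i1)
    ... | pendant x refl    = <⇒≢ (s≤s z≤n) (≡-trans (≡-sym (proj₂ (leaf-degrees x))) o1)

  network-arboreal : UAcyclic (V₂ 𝒞) E₂ → Arboreal network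
  network-arboreal ac = network-connected ,
    acyclic-pullback {E = E₂} at at-injective at-V₂ (λ {i} {j} → arcN⇒E₂ {i} {j}) ac

  network-represents : Represents network G
  network-represents x y x≢y = mk⇔ shared adjacent
    where
    reach : ∀ {Q} → MaxClique G Q → ∀ {x} → x ∈ Q → ∀ i → at i ≡ nd Q → Reach arcN i (leafN x)
    reach mQ {x} x∈ i e = UWalk⇒Reach
      (walk-position {E = Arc₂ 𝒞} (λ {u} {v} a → proj₂ (arc₂-V₂ {u} {v} a)) (λ {i} {j} → arcN⁺ {i} {j})
        (to-leaf _ ≤-refl (max⇒𝒞 mQ) x∈) i (leafN x) e (at-leafN x))
    shared : x ~ y → ShareAncestor network x y
    shared e with edge⇒max e
    ... | Q , mQ , x∈ , y∈ with position (nd Q) (inj₁ (max⇒𝒞 mQ))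
    ...   | i , p = i , reach mQ x∈ i p , reach mQ y∈ i p
    in-carrier : ∀ {i x} → Reach arcN i (leafN x) → x ∈ carrier (at i)
    in-carrier {i} {x} r =
      reach-carrier r (subst (x ∈_) (≡-sym (≡-trans (cong carrier (at-leafN x)) (leafV-carrier x))) (x∈⁅x⁆ x))
    V₁-adj : ∀ {A} → V₁ 𝒞 A → x ∈ A → y ∈ A → x ~ y
    V₁-adj (inj₁ c) x∈ y∈ with contained c
    ... | Q , (cQ , _) , s = proj₂ cQ x y (s x∈) (s y∈) x≢y
    V₁-adj (inj₂ (z , refl , _)) x∈ y∈ = ⊥-elim (x≢y (≡-trans (x∈⁅y⁆⇒x≡y z x∈) (≡-sym (x∈⁅y⁆⇒x≡y z y∈))))
    carrier-V₁ : ∀ v → V₂ 𝒞 v → V₁ 𝒞 (carrier v)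
    carrier-V₁ (nd A) v = v
    carrier-V₁ (pd A) v = proj₁ v
    adjacent : ShareAncestor network x y → x ~ y
    adjacent (i , r , r′) = V₁-adj (carrier-V₁ (at i) (at-V₂ i)) (in-carrier r) (in-carrier r′)

  maxCliques : List (Subset n)
  maxCliques = satisfying _≟S_ (subsets n) ∈-subsets maxClique?

  maxCliques-unique : Unique maxCliques
  maxCliques-unique = satisfying-unique _≟S_ (subsets n) ∈-subsets maxClique?

  ∈-maxCliques⁺ : ∀ {Q} → MaxClique G Q → Q ∈ₗ maxCliques
  ∈-maxCliques⁺ = ∈-satisfying⁺ _≟S_ (subsets n) ∈-subsets maxClique?

  ∈-maxCliques⁻ : ∀ {Q} → Q ∈ₗ maxCliques → MaxClique G Q
  ∈-maxCliques⁻ = ∈-satisfying⁻ _≟S_ (subsets n) ∈-subsets maxClique?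

  numMaxCliques : NumMaxCliques G (length maxCliques)
  numMaxCliques = maxCliques , maxCliques-unique , (λ Y → mk⇔ ∈-maxCliques⁻ ∈-maxCliques⁺) , refl

  private
    isRoot : Fin (length L) → Bool
    isRoot i = indegN i ≡ᵇ 0

    root⇒max : ∀ i → isRoot i ≡ true → ∃[ Q ] (MaxClique G Q × at i ≡ nd Q)
    root⇒max i h with ≡ᵇ⇒≡ (indegN i) 0 (subst T (≡-sym h) tt) | degrees i
    ... | i0 | joining i≥2 _  = ⊥-elim (<⇒≱ i≥2 (≤-trans (≤-reflexive i0) z≤n))
    ... | i0 | pendant x refl = ⊥-elim (<⇒≢ (s≤s z≤n) (≡-trans (≡-sym i0) (proj₁ (leaf-degrees x))))
    ... | i0 | branching {A} e cA _ with contained cA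
    ...   | Q , mQ , A⊆Q with A ⊂? Q
    ...     | no ¬s = Q , mQ , ≡-trans e (cong nd (⊆-antisym A⊆Q (⊆∧⊄⇒⊇ A⊆Q ¬s)))
    ...     | yes s with cover-above cA (max⇒𝒞 mQ) s
    ...       | E , arc , _ =
      ⊥-elim (<⇒≱ (in-≥1 i {nd E} (subst (Arc₂ 𝒞 (nd E)) (≡-sym e) (inj₁ arc))) (≤-reflexive i0))

    max⇒root : ∀ {Q} → MaxClique G Q → ∀ i → at i ≡ nd Q → isRoot i ≡ true
    max⇒root {Q} mQ@(_ , max) i e = is-true (≡⇒≡ᵇ (indegN i) 0 (countF-zero (λ j → arcN j i) no-parent))
      where
      is-true : ∀ {b} → T b → b ≡ true
      is-true {true} _ = refl
      none : ∀ v → ¬ Arc₂ 𝒞 v (nd Q)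
      none (nd A) a with arc₁-⊂ a | contained (arc₁-source a)
      ... | Q⊆A , x , x∈A , x∉Q | P , mP , A⊆P =
        x∉Q (subst (x ∈_) (max P (proj₁ mP) (λ y∈ → A⊆P (Q⊆A y∈))) (A⊆P x∈A))
      no-parent : ∀ j → arcN j i ≢ true
      no-parent j h = none (at j) (subst (Arc₂ 𝒞 (at j)) e (arcN⁻ {j} {i} h))

  numRoots-network : numRoots network ≡ length maxCliques
  numRoots-network = ≡-trans (≡-sym (length-trues isRoot)) (≤-antisym
    (matching-length (λ i Q → at i ≡ nd Q) (λ p q → at-injective (≡-trans p (≡-sym q))) (trues-unique isRoot)
      (λ {i} i∈ → let Q , mQ , e = root⇒max i (∈-trues⁻ isRoot i∈) in Q , ∈-maxCliques⁺ mQ , e))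
    (matching-length (λ Q i → at i ≡ nd Q) (λ p q → nd-injective (≡-trans (≡-sym p) q)) maxCliques-unique
      (λ {Q} Q∈ → let i , e = position (nd Q) (inj₁ (max⇒𝒞 (∈-maxCliques⁻ Q∈))) in
                  i , ∈-trues⁺ isRoot (max⇒root (∈-maxCliques⁻ Q∈) i e) , e)))
    where
    nd-injective : ∀ {A B : Subset n} → nd A ≡ nd B → A ≡ B
    nd-injective refl = refl

  ptolemaic⇒ecc : Ptolemaic G → IsEcc G (length maxCliques)
  ptolemaic⇒ecc pt =
    (maxCliques , (maxCliques-unique , All.tabulate (λ Q∈ → proj₁ (∈-maxCliques⁻ Q∈)) , covers) , refl) , minimum
    where
    covers : ∀ x y → x ~ y → Any (λ Y → x ∈ Y × y ∈ Y) maxCliques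
    covers x y e with edge⇒max e
    ... | Q , mQ , x∈ , y∈ = lose (∈-maxCliques⁺ mQ) (x∈ , y∈)
    Owns : Subset n → Subset n → Set
    Owns Q Y = Clique G Y × ∃[ x ] ∃[ y ] (x ∈ Y × y ∈ Y × (∀ P → MaxClique G P → x ∈ P → y ∈ P → P ≡ Q))
    Owns-injective : ∀ {Q Q′ Y} → Owns Q Y → Owns Q′ Y → Q ≡ Q′
    Owns-injective (cY , x , y , x∈ , y∈ , u) (_ , x′ , y′ , x′∈ , y′∈ , u′) with clique⇒max cY
    ... | P , mP , s = ≡-trans (≡-sym (u P mP (s x∈) (s y∈))) (u′ P mP (s x′∈) (s y′∈))
    minimum : ∀ K → EdgeCliqueCover G K → length maxCliques ≤ length K
    minimum K (_ , cliques , cov) = matching-length Owns Owns-injective maxCliques-unique owner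
      where
      owner : ∀ {Q} → Q ∈ₗ maxCliques → ∃[ Y ] (Y ∈ₗ K × Owns Q Y)
      owner Q∈ with HAcyclic.private-edge G con pt (∈-maxCliques⁻ Q∈)
      ... | x , y , _ , _ , e , u with find (cov x y e)
      ...   | Y , Y∈ , x∈Y , y∈Y = Y , Y∈ , All.lookup cliques Y∈ , x , y , x∈Y , y∈Y , u

theorem6p4 : (n : ℕ) (G : Graph n) → 2 ≤ n → Connected G →
    (Ptolemaic G ⇔ UAcyclic (IntersectionClosure (MaxClique G)) (Und (HArc (IntersectionClosure (MaxClique G)))))
    × (Ptolemaic G ⇔ NArboreal (MaxClique G))
    × (Ptolemaic G ⇔ ArborealRepresentable G)
    × (Ptolemaic G ⇔ (∃[ N ] (Arboreal N × Represents N G × (∃[ k ] (IsEcc G k × NumMaxCliques G k × numRoots N ≡ k)))))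
theorem6p4 n G 2≤n con =
  mk⇔ i⇒ii ii⇒i ,
  mk⇔ (λ pt → H-acyclic⇒N-arboreal (i⇒ii pt)) (λ (_ , ac) → N-acyclic⇒i ac) ,
  mk⇔ (λ pt → network , i⇒arboreal pt , network-represents) (λ (N , arb , rep) → arboreal⇒ptolemaic N G arb rep) ,
  mk⇔ (λ pt → network , i⇒arboreal pt , network-represents ,
              length maxCliques , ptolemaic⇒ecc pt , numMaxCliques , numRoots-network)
      (λ (N , arb , rep , _) → arboreal⇒ptolemaic N G arb rep)
  where
  open NDigraph G 2≤n con
  open Construction G 2≤n con
  i⇒ii : Ptolemaic G → UAcyclic 𝒞 (Und H)
  i⇒ii = HAcyclic.H-acyclic G con
  N-acyclic⇒i : UAcyclic (V₂ 𝒞) E₂ → Ptolemaic G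
  N-acyclic⇒i ac = arboreal⇒ptolemaic network G (network-arboreal ac) network-represents
  ii⇒i : UAcyclic 𝒞 (Und H) → Ptolemaic G
  ii⇒i ac = N-acyclic⇒i (N-acyclic ac)
  i⇒arboreal : Ptolemaic G → Arboreal network
  i⇒arboreal pt = network-arboreal (N-acyclic (i⇒ii pt))
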